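{- Let $X\subset\mathbb{R}^n$ be a non-empty convex set and $\mathcal{A}\subset\mathbb{R}^n$ a non-empty finite set such that the functions $x\mapsto\exp(\alpha^Tx)$, $\alpha\in\mathcal{A}$, are linearly independent on $X$. Let $\beta\in\mathcal{A}$ and $\lambda\in\Lambda_X(\mathcal{A},\beta)$. If there exist $\beta'\in\mathcal{A}\setminus\operatorname{supp}\lambda$ and some normalized $\lambda'\in N_{\beta'}$ (i.e. $\lambda'_{\beta'}=-1$) with $(\lambda')^+\subset\operatorname{supp}\lambda$ and $\mathcal{A}\lambda'=\gamma\,\mathcal{A}\lambda$ for some $\gamma\ge0$, then $\lambda$ is not reduced.
   Context: $\mathbb{R}^{\mathcal{A}}$ is the set of real vectors indexed by $\mathcal{A}$. For $\beta\in\mathcal{A}$, $N_\beta=\{\nu\in\mathbb{R}^{\mathcal{A}} : \nu_\alpha\ge 0 \text{ for all }\alpha\in\mathcal{A}\setminus\{\beta\},\ \sum_{\alpha\in\mathcal{A}}\nu_\alpha=0\}$. For $\nu\in\mathbb{R}^{\mathcal{A}}$ write $\mathcal{A}\nu=\sum_{\alpha\in\mathcal{A}}\alpha\,\nu_\alpha\in\mathbb{R}^n$. $\sigma_X(y)=\sup\{y^Tx : x\in X\}$ is the support function. A non-zero vector $\nu^*\in N_\beta$ is an $X$-circuit (sublinear circuit of $\mathcal{A}$ with respect to $X$) if (i) $\sigma_X(-\mathcal{A}\nu^*)<\infty$, and (ii) whenever the map $\nu\mapsto\sigma_X(-\mathcal{A}\nu)$ is linear on a two-dimensional convex cone contained in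 $N_\beta$ (i.e. is finite there and coincides there with a linear function), $\nu^*$ is not in the relative interior of that cone. $\Lambda_X(\mathcal{A},\beta)$ denotes the set of $X$-circuits $\lambda\in N_\beta$ with $\lambda_\beta=-1$ (normalized), and $\Lambda_X(\mathcal{A})=\bigcup_{\beta\in\mathcal{A}}\Lambda_X(\mathcal{A},\beta)$. $\operatorname{supp}\lambda=\{\alpha\in\mathcal{A}:\lambda_\alpha\neq0\}$ and $\lambda^+=\{\alpha\in\mathcal{A}:\lambda_\alpha>0\}$. The circuit graph is the convex cone $G_X(\mathcal{A})=\operatorname{cone}\left(\{(\lambda,\sigma_X(-\mathcal{A}\lambda)) : \lambda\in\Lambda_X(\mathcal{A})\}\cup\{(\mathbf{0},1)\}\right)\subset\mathbb{R}^{\mathcal{A}}\times\mathbb{R}$ (conic hull). An $X$-circuit $\nu$ is reduced if its extended form $(\nu,\sigma_X(-\mathcal{A}\nu))$ generates an extreme ray of $G_X(\mathcal{A})$. -}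

module Defs where

open import Algebra.Bundles using (CommutativeRing; Semiring)
import Algebra.Definitions.RawSemiring as RawSemiringOps
open import Data.Fin using (Fin; toℕ)
open import Data.Nat.Base as ℕ using (ℕ; _!)
open import Data.Product using (Σ-syntax; ∃; ∃-syntax; _×_; _,_)
open import Data.Sum using (_⊎_)
open import Data.Vec.Functional using (Vector; map; zipWith; replicate)
open import Function.Bundles using (_⇔_)
open import Level using (Level; 0ℓ) renaming (suc to lsuc)
open import Relation.Binary.Core using (Rel)
open import Relation.Binary.Definitions using (_Respects_)
open import Relation.Binary.PropositionalEquality using (_≡_)
open import Relation.Binary.Structures using (IsTotalOrder)
open import Relation.Nullary using (¬_)
open import Relation.Unary using (Pred; _∈_; _∉_; _⊆_; Satisfiable)

-- The standard library has no real numbers. The reals are taken to be an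
-- arbitrary Dedekind-complete ordered field; classically there is exactly one
-- up to isomorphism.
record CompleteOrderedField : Set₁ where
  field
    commutativeRing : CommutativeRing 0ℓ 0ℓ

  open CommutativeRing commutativeRing public
    renaming (Carrier to ℝ)

  infix 4 _≤_ _<_
  infix 8 _⁻¹

  field
    _≤_          : Rel ℝ 0ℓ
    isTotalOrder : IsTotalOrder _≈_ _≤_
    0≉1          : ¬ (0# ≈ 1#)
    _⁻¹          : ℝ → ℝ              -- the value at zero is arbitrary
    ⁻¹-inverseʳ  : ∀ x → ¬ (x ≈ 0#) → x * x ⁻¹ ≈ 1#
    +-monoˡ-≤    : ∀ {x y} z → x ≤ y → x + z ≤ y + z
    *-nonneg     : ∀ {x y} → 0# ≤ x → 0# ≤ y → 0# ≤ x * y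

  _<_ : Rel ℝ 0ℓ
  x < y = x ≤ y × ¬ (x ≈ y)

  IsUpperBound : Pred ℝ 0ℓ → ℝ → Set
  IsUpperBound S b = ∀ x → x ∈ S → x ≤ b

  IsSupremum : Pred ℝ 0ℓ → ℝ → Set
  IsSupremum S s = IsUpperBound S s × (∀ b → IsUpperBound S b → s ≤ b)

  field
    complete : ∀ (S : Pred ℝ 0ℓ) → Satisfiable S → ∃ (IsUpperBound S) →
               ∃ (IsSupremum S)


module ConvexGeometry (R : CompleteOrderedField) where

  open CompleteOrderedField R public
  open RawSemiringOps (Semiring.rawSemiring semiring) public
    using (_^_; sum) renaming (_×_ to _·ℕ_)

  private
    variable
      ℓ : Level
      k m n : ℕ

  _⟶_ : (ℕ → ℝ) → ℝ → Set
  a ⟶ l = ∀ ε → 0# < ε →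
    ∃[ N ] ∀ j → N ℕ.≤ j → (l - ε < a j) × (a j < l + ε)

  expPartialSum : ℝ → ℕ → ℝ
  expPartialSum x j = sum {j} λ i → x ^ toℕ i * ((toℕ i !) ·ℕ 1#) ⁻¹

  IsExponential : (ℝ → ℝ) → Set
  IsExponential exp = ∀ x → expPartialSum x ⟶ exp x

  ℝ^ : ℕ → Set
  ℝ^ n = Vector ℝ n

  infix  4 _≋_
  infixl 6 _⊕_ _⊖_
  infixr 7 _⊙_
  infixl 7 _∙_

  _≋_ : Rel (ℝ^ n) 0ℓ
  u ≋ v = ∀ i → u i ≈ v i

  𝟎 : ℝ^ n
  𝟎 = replicate _ 0#

  _⊕_ _⊖_ : ℝ^ n → ℝ^ n → ℝ^ n
  _⊕_ = zipWith _+_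
  _⊖_ = zipWith _-_

  ⊝_ : ℝ^ n → ℝ^ n
  ⊝_ = map (-_)

  _⊙_ : ℝ → ℝ^ n → ℝ^ n
  c ⊙ v = map (c *_) v

  _∙_ : ℝ^ n → ℝ^ n → ℝ
  u ∙ v = sum (zipWith _*_ u v)

  combination : Vector ℝ k → Vector (ℝ^ n) k → ℝ^ n
  combination c v j = sum λ i → c i * v i j

  LinearlyIndependent : Vector (ℝ^ n) k → Set
  LinearlyIndependent v = ∀ c → combination c v ≋ 𝟎 → c ≋ 𝟎

  LinearlyIndependentOn : Pred (ℝ^ n) 0ℓ → Vector (ℝ^ n → ℝ) m → Set
  LinearlyIndependentOn X f =
    ∀ c → (∀ x → x ∈ X → sum (λ i → c i * f i x) ≈ 0#) → c ≋ 𝟎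

  record IsLinear (f : ℝ^ n → ℝ) : Set where
    field
      cong        : ∀ {u v} → u ≋ v → f u ≈ f v
      additive    : ∀ u v → f (u ⊕ v) ≈ f u + f v
      homogeneous : ∀ c v → f (c ⊙ v) ≈ c * f v

  -- Subsets of ℝⁿ are predicates respecting the equality of ℝⁿ.
  record IsConvex (X : Pred (ℝ^ n) 0ℓ) : Set where
    field
      respects : X Respects _≋_
      convex   : ∀ {x y} t → 0# ≤ t → t ≤ 1# → x ∈ X → y ∈ X →
                 (t ⊙ x) ⊕ ((1# - t) ⊙ y) ∈ X

  record IsConvexCone (C : Pred (ℝ^ n) 0ℓ) : Set where
    field
      respects : C Respects _≋_
      nonempty : Satisfiable C
      +-closed : ∀ {x y} → x ∈ C → y ∈ C → x ⊕ y ∈ C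
      *-closed : ∀ {x} t → 0# ≤ t → x ∈ C → t ⊙ x ∈ C

  affineHull : Pred (ℝ^ n) 0ℓ → Pred (ℝ^ n) 0ℓ
  affineHull {n} C y =
    ∃[ k ] Σ[ c ∈ Vector ℝ k ] Σ[ p ∈ Vector (ℝ^ n) k ]
      (∀ i → p i ∈ C) × sum c ≈ 1# × y ≋ combination c p

  -- The affine hull is a translate of a k-dimensional linear subspace.
  HasDimension : ℕ → Pred (ℝ^ n) 0ℓ → Set
  HasDimension {n} k C =
    Σ[ p ∈ ℝ^ n ] Σ[ b ∈ Vector (ℝ^ n) k ]
      LinearlyIndependent b ×
      (∀ y → y ∈ affineHull C ⇔ (∃[ c ] y ≋ p ⊕ combination c b))

  relativeInterior : Pred (ℝ^ n) 0ℓ → Pred (ℝ^ n) 0ℓ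
  relativeInterior C x =
    x ∈ C ×
    ∃[ ε ] 0# < ε ×
      (∀ y → y ∈ affineHull C → (y ⊖ x) ∙ (y ⊖ x) < ε * ε → y ∈ C)

  -- σ_X y = s with s real. For X non-empty, σ_X y < ∞ iff such an s exists.
  SupportValue : Pred (ℝ^ n) 0ℓ → ℝ^ n → ℝ → Set
  SupportValue X y = IsSupremum λ v → ∃[ x ] x ∈ X × v ≈ y ∙ x

  Extended : ℕ → Set
  Extended m = ℝ^ m × ℝ

  infix  4 _≋ₑ_
  infixl 6 _⊕ₑ_
  infixr 7 _⊙ₑ_

  _≋ₑ_ : Rel (Extended m) 0ℓ
  (u , s) ≋ₑ (v , t) = u ≋ v × s ≈ t

  𝟎ₑ : Extended m
  𝟎ₑ = 𝟎 , 0#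

  _⊕ₑ_ : Extended m → Extended m → Extended m
  (u , s) ⊕ₑ (v , t) = u ⊕ v , s + t

  _⊙ₑ_ : ℝ → Extended m → Extended m
  c ⊙ₑ (v , t) = c ⊙ v , c * t

  conicHull : Pred (Extended m) ℓ → Pred (Extended m) ℓ
  conicHull {m} S (y , s) =
    ∃[ k ] Σ[ c ∈ Vector ℝ k ] Σ[ v ∈ Vector (ℝ^ m) k ] Σ[ t ∈ Vector ℝ k ]
      (∀ i → 0# ≤ c i) × (∀ i → (v i , t i) ∈ S) ×
      (y , s) ≋ₑ (combination c v , c ∙ t)

  ray : Extended m → Pred (Extended m) 0ℓ
  ray p q = ∃[ t ] 0# ≤ t × q ≋ₑ t ⊙ₑ p

  record GeneratesExtremeRay (K : Pred (Extended m) ℓ) (p : Extended m) : Set ℓ where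
    field
      nonzero : ¬ (p ≋ₑ 𝟎ₑ)
      member  : p ∈ K
      extreme : ∀ u v → u ∈ K → v ∈ K → u ⊕ₑ v ∈ ray p → u ∈ ray p × v ∈ ray p

  -- A finite set 𝒜 ⊂ ℝⁿ is given by an enumeration of its elements (required to
  -- be injective where the theory is applied), so that ℝ^𝒜 is ℝ^ m and elements
  -- of 𝒜 are named by their indices.
  module SublinearCircuits {n m : ℕ}
    (X : Pred (ℝ^ n) 0ℓ) (𝒜 : Vector (ℝ^ n) m) where

    𝒜[_] : ℝ^ m → ℝ^ n
    𝒜[ ν ] = combination ν 𝒜

    N : Fin m → Pred (ℝ^ m) 0ℓ
    N β ν = (∀ α → ¬ (α ≡ β) → 0# ≤ ν α) × sum ν ≈ 0#

    supp : ℝ^ m → Pred (Fin m) 0ℓ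
    supp ν α = ¬ (ν α ≈ 0#)

    _⁺ : ℝ^ m → Pred (Fin m) 0ℓ
    (ν ⁺) α = 0# < ν α

    -- s is the value of ν ↦ σ_X(-𝒜ν), which in particular is finite at ν.
    σ[-𝒜_]≈_ : ℝ^ m → ℝ → Set
    σ[-𝒜 ν ]≈ s = SupportValue X (⊝ 𝒜[ ν ]) s

    σ-LinearOn : Pred (ℝ^ m) 0ℓ → Set
    σ-LinearOn C = ∃[ f ] IsLinear f × (∀ ν → ν ∈ C → σ[-𝒜 ν ]≈ f ν)

    record IsCircuit (β : Fin m) (ν : ℝ^ m) : Set₁ where
      field
        nonzero : ¬ (ν ≋ 𝟎)
        member  : ν ∈ N β
        finite  : ∃[ s ] σ[-𝒜 ν ]≈ s
        minimal : ∀ (C : Pred (ℝ^ m) 0ℓ) → IsConvexCone C → HasDimension 2 C →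
                  C ⊆ N β → σ-LinearOn C → ν ∉ relativeInterior C

    Λ : Fin m → Pred (ℝ^ m) (lsuc 0ℓ)
    Λ β ν = IsCircuit β ν × ν β ≈ - 1#

    circuitGenerators : Pred (Extended m) (lsuc 0ℓ)
    circuitGenerators (ν , s) =
      ((∃[ β ] ν ∈ Λ β) × σ[-𝒜 ν ]≈ s) ⊎ ((ν , s) ≋ₑ (𝟎 , 1#))

    circuitGraph : Pred (Extended m) (lsuc 0ℓ)
    circuitGraph = conicHull circuitGenerators

    IsReduced : ℝ^ m → Set₁
    IsReduced ν =
      (∃[ β ] IsCircuit β ν) ×
      (∃[ s ] σ[-𝒜 ν ]≈ s × GeneratesExtremeRay circuitGraph (ν , s))

{-# OPTIONS --safe #-}
module Submission where

-- Put C = γ + Σ c_α, with c_α ≥ 0 large enough that Cν - ν′ ∈ N β. As 𝒜ν′ = γ 𝒜ν,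
-- the values of σ_X(-𝒜·) at ν′ and at Cν - ν′ are γ σ_X(-𝒜ν) and (C - γ) σ_X(-𝒜ν), so
-- C (ν , σ_X(-𝒜ν)) splits as a sum of the extended forms of Cν - ν′ and ν′. Both lie
-- in the circuit graph: by Minkowski's theorem every point of the closed pointed
-- cone { (μ , τ) : μ ∈ N β , σ_X(-𝒜μ) ≤ τ } is a sum of points on extreme rays, and
-- a point (μ , τ) on an extreme ray has μ = 𝟎 or a circuit μ with τ = σ_X(-𝒜μ). But
-- ν′ is not a multiple of ν, since ν vanishes at β′ and ν′ does not.

open import Defs
open import Algebra.Solver.Ring.AlmostCommutativeRing
  using (fromCommutativeRing; _-Raw-AlmostCommutative⟶_)
open import Axiom.DoubleNegationElimination using (em⇒dne)
open import Axiom.ExcludedMiddle using (ExcludedMiddle)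
open import Data.Fin using (Fin; zero; suc; punchIn)
open import Data.Fin.Properties using (_≟_; punchInᵢ≢i)
open import Data.Integer.Base using (ℤ; +_; -[1+_]; 1ℤ)
import Data.Integer.Base as ℤ
import Data.Integer.Properties as ℤ
open import Data.Maybe.Base using (Maybe)
import Data.Maybe.Base as Maybe
open import Data.Nat.Base using (ℕ; zero; suc; NonZero)
import Data.Nat.Base as ℕ
import Data.Nat.Properties as ℕ
open import Data.Product using (∃; ∃-syntax; _×_; _,_; proj₁; proj₂)
open import Data.Sum using (inj₁; inj₂)
open import Data.Vec.Functional using (Vector; _∷_; []; tail; removeAt)
open import Function.Base using (_∘_)
open import Function.Bundles using (Equivalence)
open import Function.Definitions using (Injective)
open import Level using (Level; 0ℓ; Lift; lift; lower) renaming (suc to lsuc)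
open import Relation.Binary.Definitions using (_Respects_)
open import Relation.Binary.PropositionalEquality as ≡ using (_≡_)
open import Relation.Nullary using (¬_; yes; no; contradiction)
open import Relation.Nullary.Decidable using (dec⇒maybe; map′)
open import Relation.Unary using (Pred; _∈_; _∉_; _⊆_; Satisfiable)

-- Extremality of the ray through `(ν , s)` refers to splittings inside the circuit graph, so both
-- summands must be exhibited as conic combinations of normalized circuits; this is the main cost.
-- One summand lives over `N β`, the other over `N β′`, so the decomposition is proved for an
-- arbitrary index. The cone has one halfspace for each point of `X`, hence need not be polyhedral,
-- and its extreme rays cannot be enumerated. Minkowski's theorem is therefore proved by descent on
-- the dimension of the smallest face containing a point. Completeness of the reals enters only in
-- finding where a line leaves the cone; pointedness, in the form of a positive functional, makes
-- the line leave it in both directions. An extreme ray yields a circuit for this reason: a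
-- two-dimensional cone with `ν` in its relative interior on which the support function is linear
-- lifts, along that linear function, into the face of the extended point, and that face is then too
-- large.

module IntegerCoefficients (R : CompleteOrderedField) where

  open CompleteOrderedField R hiding (zero)
  open import Algebra.Properties.Ring ring
  open import Algebra.Properties.Group +-group using (ε⁻¹≈ε; ⁻¹-involutive)
  open import Algebra.Properties.AbelianGroup +-abelianGroup using (⁻¹-∙-comm)
  open import Algebra.Properties.Semiring.Mult.TCOptimised semiring
    using (1+×; ×-homo-+; ×1-homo-*) renaming (_×_ to _·_)
  open import Relation.Binary.Reasoning.Setoid setoid

  -- With this multiple, `1 · x` computes to `x`, so the solver constants 0, 1 and -1 denote `0#`,
  -- `1#` and `- 1#` definitionally and match goals that contain them.
  ⟦_⟧ : ℤ → ℝ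
  ⟦ + n ⟧      = n · 1#
  ⟦ -[1+ n ] ⟧ = - (suc n · 1#)

  ⟦⟧-neg : ∀ i → ⟦ ℤ.- i ⟧ ≈ - ⟦ i ⟧
  ⟦⟧-neg (+ zero)   = sym ε⁻¹≈ε
  ⟦⟧-neg (+ suc n)  = refl
  ⟦⟧-neg -[1+ n ]   = sym (⁻¹-involutive _)

  [c+x]-[c+y] : ∀ c x y → (c + x) - (c + y) ≈ x - y
  [c+x]-[c+y] c x y = begin
    (c + x) - (c + y)     ≈⟨ +-congˡ (⁻¹-∙-comm c y) ⟨
    (c + x) + (- c - y)   ≈⟨ +-congʳ (+-comm c x) ⟩
    (x + c) + (- c - y)   ≈⟨ +-assoc x c _ ⟩
    x + (c + (- c - y))   ≈⟨ +-congˡ (+-assoc c (- c) (- y)) ⟨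
    x + ((c - c) - y)     ≈⟨ +-congˡ (+-congʳ (-‿inverseʳ c)) ⟩
    x + (0# - y)          ≈⟨ +-congˡ (+-identityˡ _) ⟩
    x - y                 ∎

  ⟦⟧-⊖ : ∀ m n → ⟦ m ℤ.⊖ n ⟧ ≈ m · 1# - n · 1#
  ⟦⟧-⊖ m       zero    = sym (trans (+-congˡ ε⁻¹≈ε) (+-identityʳ _))
  ⟦⟧-⊖ zero    (suc n) = sym (+-identityˡ _)
  ⟦⟧-⊖ (suc m) (suc n) = begin
    ⟦ suc m ℤ.⊖ suc n ⟧                ≡⟨ ≡.cong ⟦_⟧ (ℤ.[1+m]⊖[1+n]≡m⊖n m n) ⟩
    ⟦ m ℤ.⊖ n ⟧                        ≈⟨ ⟦⟧-⊖ m n ⟩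
    m · 1# - n · 1#                  ≈⟨ [c+x]-[c+y] 1# _ _ ⟨
    (1# + m · 1#) - (1# + n · 1#)    ≈⟨ +-cong (1+× m 1#) (-‿cong (1+× n 1#)) ⟨
    suc m · 1# - suc n · 1#          ∎

  ⟦⟧-+ : ∀ i j → ⟦ i ℤ.+ j ⟧ ≈ ⟦ i ⟧ + ⟦ j ⟧
  ⟦⟧-+ (+ m)    (+ n)    = ×-homo-+ 1# m n
  ⟦⟧-+ (+ m)    -[1+ n ] = ⟦⟧-⊖ m (suc n)
  ⟦⟧-+ -[1+ m ] (+ n)    = trans (⟦⟧-⊖ n (suc m)) (+-comm _ _)
  ⟦⟧-+ -[1+ m ] -[1+ n ] = begin
    - (suc (suc (m ℕ.+ n)) · 1#)       ≡⟨ ≡.cong (λ k → - (suc k · 1#)) (ℕ.+-suc m n) ⟨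
    - ((suc m ℕ.+ suc n) · 1#)         ≈⟨ -‿cong (×-homo-+ 1# (suc m) (suc n)) ⟩
    - (suc m · 1# + suc n · 1#)        ≈⟨ ⁻¹-∙-comm _ _ ⟨
    - (suc m · 1#) - suc n · 1#        ∎

  ⟦⟧-+* : ∀ m j → ⟦ + m ℤ.* j ⟧ ≈ m · 1# * ⟦ j ⟧
  ⟦⟧-+* m (+ n)    = begin
    ⟦ + m ℤ.* + n ⟧     ≡⟨ ≡.cong ⟦_⟧ (ℤ.pos-* m n) ⟨
    (m ℕ.* n) · 1#      ≈⟨ ×1-homo-* m n ⟩
    m · 1# * n · 1#     ∎
  ⟦⟧-+* m -[1+ n ] = begin
    ⟦ + m ℤ.* -[1+ n ] ⟧       ≡⟨ ≡.cong ⟦_⟧ (ℤ.neg-distribʳ-* (+ m) (+ suc n)) ⟨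
    ⟦ ℤ.- (+ m ℤ.* + suc n) ⟧  ≈⟨ ⟦⟧-neg (+ m ℤ.* + suc n) ⟩
    - ⟦ + m ℤ.* + suc n ⟧      ≈⟨ -‿cong (⟦⟧-+* m (+ suc n)) ⟩
    - (m · 1# * suc n · 1#)    ≈⟨ -‿distribʳ-* _ _ ⟩
    m · 1# * - (suc n · 1#)    ∎

  ⟦⟧-* : ∀ i j → ⟦ i ℤ.* j ⟧ ≈ ⟦ i ⟧ * ⟦ j ⟧
  ⟦⟧-* (+ m)    j = ⟦⟧-+* m j
  ⟦⟧-* -[1+ m ] j = begin
    ⟦ -[1+ m ] ℤ.* j ⟧         ≡⟨ ≡.cong ⟦_⟧ (ℤ.neg-distribˡ-* (+ suc m) j) ⟨
    ⟦ ℤ.- (+ suc m ℤ.* j) ⟧    ≈⟨ ⟦⟧-neg (+ suc m ℤ.* j) ⟩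
    - ⟦ + suc m ℤ.* j ⟧        ≈⟨ -‿cong (⟦⟧-+* (suc m) j) ⟩
    - (suc m · 1# * ⟦ j ⟧)     ≈⟨ -‿distribˡ-* _ _ ⟩
    - (suc m · 1#) * ⟦ j ⟧     ∎

  -- The solver compares coefficients while normalising. Integer equality is decidable, whereas no
  -- decision procedure for `ℝ` is assumed here.
  morphism : ℤ.+-*-rawRing -Raw-AlmostCommutative⟶ fromCommutativeRing commutativeRing
  morphism = record
    { ⟦_⟧    = ⟦_⟧
    ; +-homo = ⟦⟧-+
    ; *-homo = ⟦⟧-*
    ; -‿homo = ⟦⟧-neg
    ; 0-homo = refl
    ; 1-homo = refl
    }

  _≈?_ : ∀ i j → Maybe (⟦ i ⟧ ≈ ⟦ j ⟧)
  i ≈? j = Maybe.map (reflexive ∘ ≡.cong ⟦_⟧) (dec⇒maybe (i ℤ.≟ j))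

  open import Algebra.Solver.Ring ℤ.+-*-rawRing (fromCommutativeRing commutativeRing)
    morphism _≈?_ public
    using (solve; _:=_; _:+_; _:*_; _:-_; :-_; con)

-- Consequences of the ordered field axioms.

module OrderedFieldProperties (R : CompleteOrderedField) where

  open CompleteOrderedField R hiding (zero)
  open IntegerCoefficients R
  open import Relation.Binary.Structures using (IsTotalOrder)
  open IsTotalOrder isTotalOrder public
    using (antisym; total; ≤-resp-≈)
    renaming (refl to ≤-refl; trans to ≤-trans; reflexive to ≤-reflexive)

  ≤-resp₂ : ∀ {x y x′ y′} → x ≈ x′ → y ≈ y′ → x ≤ y → x′ ≤ y′
  ≤-resp₂ p q = proj₁ ≤-resp-≈ q ∘ proj₂ ≤-resp-≈ p

  nonneg-resp : ∀ {x y} → x ≈ y → 0# ≤ x → 0# ≤ y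
  nonneg-resp = proj₁ ≤-resp-≈

  ≤⇒0≤- : ∀ {x y} → x ≤ y → 0# ≤ y - x
  ≤⇒0≤- {x} = ≤-resp₂ (-‿inverseʳ x) refl ∘ +-monoˡ-≤ (- x)

  0≤-⇒≤ : ∀ {x y} → 0# ≤ y - x → x ≤ y
  0≤-⇒≤ {x} {y} = ≤-resp₂ (+-identityˡ x)
    (solve 2 (λ x y → (y :- x) :+ x := y) refl x y) ∘ +-monoˡ-≤ x

  +-nonneg : ∀ {x y} → 0# ≤ x → 0# ≤ y → 0# ≤ x + y
  +-nonneg {x} {y} p q = ≤-trans q (≤-resp₂ (+-identityˡ y) refl (+-monoˡ-≤ y p))

  neg-nonneg : ∀ {x} → x ≤ 0# → 0# ≤ - x
  neg-nonneg {x} p = nonneg-resp (+-identityˡ (- x)) (≤⇒0≤- p)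

  neg-nonneg⁻ : ∀ {x} → 0# ≤ - x → x ≤ 0#
  neg-nonneg⁻ {x} p = 0≤-⇒≤ (nonneg-resp (sym (+-identityˡ (- x))) p)

  ≰⇒> : ∀ {x y} → ¬ (x ≤ y) → y < x
  ≰⇒> {x} {y} x≰y with total x y
  ... | inj₁ x≤y = contradiction x≤y x≰y
  ... | inj₂ y≤x = y≤x , λ y≈x → x≰y (≤-reflexive (sym y≈x))

  square-nonneg : ∀ x → 0# ≤ x * x
  square-nonneg x with total 0# x
  ... | inj₁ p = *-nonneg p p
  ... | inj₂ p = nonneg-resp (solve 1 (λ x → :- x :* :- x := x :* x) refl x)
                   (*-nonneg (neg-nonneg p) (neg-nonneg p))

  0<1 : 0# < 1#
  0<1 = nonneg-resp (*-identityʳ 1#) (square-nonneg 1#) , 0≉1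

  <-resp₂ : ∀ {x y x′ y′} → x ≈ x′ → y ≈ y′ → x < y → x′ < y′
  <-resp₂ p q (x≤y , x≉y) = ≤-resp₂ p q x≤y , λ e → x≉y (trans p (trans e (sym q)))

  <⇒0<- : ∀ {x y} → x < y → 0# < y - x
  <⇒0<- {x} {y} (x≤y , x≉y) = ≤⇒0≤- x≤y , λ e → x≉y
    (trans (solve 2 (λ x y → x := y :- (y :- x)) refl x y)
      (trans (+-congˡ (-‿cong (sym e))) (solve 1 (λ y → y :- con (+ 0) := y) refl y)))

  0<-⇒< : ∀ {x y} → 0# < y - x → x < y
  0<-⇒< {x} {y} (p , q) = 0≤-⇒≤ p , λ x≈y →
    q (sym (trans (+-congˡ (-‿cong x≈y)) (-‿inverseʳ y)))

  nonneg-antisym : ∀ {x} → 0# ≤ x → 0# ≤ - x → x ≈ 0#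
  nonneg-antisym p q = antisym (neg-nonneg⁻ q) p

  +-pos-nonneg : ∀ {x y} → 0# < x → 0# ≤ y → 0# < x + y
  +-pos-nonneg {x} {y} (p , p≉) q = +-nonneg p q , λ e → p≉ (sym (nonneg-antisym p
    (nonneg-resp (trans (solve 2 (λ x y → y := (x :+ y) :- x) refl x y)
      (trans (+-congʳ (sym e)) (+-identityˡ (- x)))) q)))

  *-cancel-zero : ∀ {x y} → ¬ (x ≈ 0#) → x * y ≈ 0# → y ≈ 0#
  *-cancel-zero {x} {y} x≉0 xy≈0 = begin
    y               ≈⟨ *-identityˡ y ⟨
    1# * y          ≈⟨ *-congʳ (⁻¹-inverseʳ x x≉0) ⟨
    x * x ⁻¹ * y    ≈⟨ solve 3 (λ x i y → x :* i :* y := i :* (x :* y)) refl x (x ⁻¹) y ⟩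
    x ⁻¹ * (x * y)  ≈⟨ *-congˡ xy≈0 ⟩
    x ⁻¹ * 0#       ≈⟨ zeroʳ _ ⟩
    0#              ∎
    where open import Relation.Binary.Reasoning.Setoid setoid

  *-pos : ∀ {x y} → 0# < x → 0# < y → 0# < x * y
  *-pos (p , p≉) (q , q≉) = *-nonneg p q , λ e → q≉ (sym (*-cancel-zero (p≉ ∘ sym) (sym e)))

  *⁻¹-inverse : ∀ {x} → 0# < x → x * x ⁻¹ ≈ 1#
  *⁻¹-inverse {x} (_ , x≉) = ⁻¹-inverseʳ x (x≉ ∘ sym)

  ⁻¹-pos : ∀ {x} → 0# < x → 0# < x ⁻¹
  ⁻¹-pos {x} x>0@(p , _) = nonneg , nonzero
    where
    nonzero : ¬ (0# ≈ x ⁻¹)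
    nonzero e = 0≉1 (trans (sym (zeroʳ x)) (trans (*-congˡ e) (*⁻¹-inverse x>0)))
    nonneg : 0# ≤ x ⁻¹
    nonneg = nonneg-resp
      (trans (solve 2 (λ x i → x :* (i :* i) := (x :* i) :* i) refl x (x ⁻¹))
        (trans (*-congʳ (*⁻¹-inverse x>0)) (*-identityˡ _)))
      (*-nonneg p (square-nonneg (x ⁻¹)))

  *-cancel-nonneg : ∀ {x y} → 0# < x → 0# ≤ x * y → 0# ≤ y
  *-cancel-nonneg {x} {y} x>0 p = nonneg-resp
    (trans (solve 3 (λ x i y → i :* (x :* y) := (x :* i) :* y) refl x (x ⁻¹) y)
      (trans (*-congʳ (*⁻¹-inverse x>0)) (*-identityˡ _)))
    (*-nonneg (proj₁ (⁻¹-pos x>0)) p)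

-- Linear functionals and nonnegative sums.

module LinearFunctionals (R : CompleteOrderedField) where

  open ConvexGeometry R hiding (zero)
  open IntegerCoefficients R
  open OrderedFieldProperties R
  open import Algebra.Properties.Semiring.Sum semiring public
    using (sum-cong-≋; ∑-distrib-+; *-distribˡ-sum; sum-remove)
  open import Relation.Binary.Reasoning.Setoid setoid

  private
    variable
      k m n : ℕ

  sum-isLinear : IsLinear (sum {n})
  sum-isLinear = record
    { cong        = sum-cong-≋
    ; additive    = ∑-distrib-+
    ; homogeneous = λ c v → sym (*-distribˡ-sum c v)
    }

  coordinate-isLinear : (i : Fin n) → IsLinear (λ v → v i)
  coordinate-isLinear i = record
    { cong        = λ e → e i
    ; additive    = λ _ _ → refl
    ; homogeneous = λ _ _ → refl
    }

  ∘-isLinear : {g : ℝ^ m → ℝ^ n} {f : ℝ^ n → ℝ} →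
               (∀ j → IsLinear (λ v → g v j)) → IsLinear f → IsLinear (f ∘ g)
  ∘-isLinear g-linear f-linear = record
    { cong        = λ e → F.cong λ j → IsLinear.cong (g-linear j) e
    ; additive    = λ u v →
        trans (F.cong λ j → IsLinear.additive (g-linear j) u v) (F.additive _ _)
    ; homogeneous = λ c v →
        trans (F.cong λ j → IsLinear.homogeneous (g-linear j) c v) (F.homogeneous c _)
    }
    where module F = IsLinear f-linear

  +-isLinear : {f g : ℝ^ n → ℝ} → IsLinear f → IsLinear g → IsLinear (λ v → f v + g v)
  +-isLinear {f = f} {g} f-linear g-linear = record
    { cong        = λ e → +-cong (F.cong e) (G.cong e)
    ; additive    = λ u v → trans (+-cong (F.additive u v) (G.additive u v))
        (solve 4 (λ a b c d → (a :+ b) :+ (c :+ d) := (a :+ c) :+ (b :+ d)) refl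
          (f u) (f v) (g u) (g v))
    ; homogeneous = λ c v → trans (+-cong (F.homogeneous c v) (G.homogeneous c v))
        (sym (distribˡ c _ _))
    }
    where
    module F = IsLinear f-linear
    module G = IsLinear g-linear

  neg-isLinear : {f : ℝ^ n → ℝ} → IsLinear f → IsLinear (λ v → - f v)
  neg-isLinear {f = f} f-linear = record
    { cong        = -‿cong ∘ F.cong
    ; additive    = λ u v → trans (-‿cong (F.additive u v))
        (solve 2 (λ a b → :- (a :+ b) := :- a :+ :- b) refl (f u) (f v))
    ; homogeneous = λ c v → trans (-‿cong (F.homogeneous c v))
        (solve 2 (λ c a → :- (c :* a) := c :* :- a) refl c (f v))
    }
    where module F = IsLinear f-linear

  ∙-isLinearˡ : (x : ℝ^ n) → IsLinear (_∙ x)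
  ∙-isLinearˡ x = ∘-isLinear
    (λ j → record
      { cong        = λ e → *-congʳ (e j)
      ; additive    = λ u v → distribʳ (x j) (u j) (v j)
      ; homogeneous = λ c v → *-assoc c (v j) (x j)
      })
    sum-isLinear

  combination-isLinear : (v : Vector (ℝ^ n) k) (j : Fin n) →
                         IsLinear (λ c → combination c v j)
  combination-isLinear v j = ∙-isLinearˡ (λ i → v i j)

  module IsLinearProperties {f : ℝ^ n → ℝ} (f-linear : IsLinear f) where

    open IsLinear f-linear

    vanishes : ∀ {v} → v ≋ 𝟎 → f v ≈ 0#
    vanishes {v} v≋𝟎 = begin
      f v           ≈⟨ cong (λ i → trans (v≋𝟎 i) (sym (zeroˡ (v i)))) ⟩
      f (0# ⊙ v)    ≈⟨ homogeneous 0# v ⟩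
      0# * f v      ≈⟨ zeroˡ _ ⟩
      0#            ∎

    negative : ∀ v → f (⊝ v) ≈ - f v
    negative v = begin
      f (⊝ v)          ≈⟨ cong (λ i → solve 1 (λ x → :- x := con ℤ.-1ℤ :* x) refl (v i)) ⟩
      f ((- 1#) ⊙ v)   ≈⟨ homogeneous (- 1#) v ⟩
      - 1# * f v       ≈⟨ solve 1 (λ x → con ℤ.-1ℤ :* x := :- x) refl (f v) ⟩
      - f v            ∎

    affine : ∀ s p d → f (s ⊙ p ⊕ d) ≈ s * f p + f d
    affine s p d = trans (additive (s ⊙ p) d) (+-congʳ (homogeneous s p))

    affine⁻ : ∀ s p d → f (s ⊙ p ⊖ d) ≈ s * f p - f d
    affine⁻ s p d = trans (affine s p (⊝ d)) (+-congˡ (negative d))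

  sum-nonneg : (v : ℝ^ n) → (∀ i → 0# ≤ v i) → 0# ≤ sum v
  sum-nonneg {zero}  v p = ≤-refl
  sum-nonneg {suc n} v p = +-nonneg (p zero) (sum-nonneg (tail v) (p ∘ suc))

  coordinate≤sum : (v : ℝ^ n) → (∀ i → 0# ≤ v i) → ∀ i → v i ≤ sum v
  coordinate≤sum {suc n} v p i = 0≤-⇒≤ (nonneg-resp
    (trans (solve 2 (λ a b → b := (a :+ b) :- a) refl (v i) _)
      (+-congʳ (sym (sum-remove {i = i} v))))
    (sum-nonneg (removeAt v i) (λ j → p (punchIn i j))))

  nonneg-sum-zero : (v : ℝ^ n) → (∀ i → 0# ≤ v i) → sum v ≈ 0# → v ≋ 𝟎
  nonneg-sum-zero v v≥0 sum≈0 i =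
    antisym (≤-resp₂ refl sum≈0 (coordinate≤sum v v≥0 i)) (v≥0 i)

  balanced-nonpos : {v : ℝ^ n} (β : Fin n) → (∀ α → ¬ (α ≡ β) → 0# ≤ v α) → sum v ≈ 0# →
                    0# ≤ - v β
  balanced-nonpos {suc n} {v} β v≥0 sum≈0 = nonneg-resp (begin
    sum (removeAt v β)                   ≈⟨ solve 2 (λ b r → r := (b :+ r) :- b) refl (v β) _ ⟩
    (v β + sum (removeAt v β)) - v β     ≈⟨ +-congʳ (sum-remove {i = β} v) ⟨
    sum v - v β                          ≈⟨ +-congʳ sum≈0 ⟩
    0# - v β                             ≈⟨ +-identityˡ _ ⟩
    - v β                                ∎)
    (sum-nonneg (removeAt v β) (λ j → v≥0 (punchIn β j) (punchInᵢ≢i β j)))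

  -- This makes `- v β` a positive functional on `N β`: it is nonnegative there and vanishes only at
  -- zero.
  balanced-zero : {v : ℝ^ n} (β : Fin n) → (∀ α → ¬ (α ≡ β) → 0# ≤ v α) → sum v ≈ 0# →
                  v β ≈ 0# → v ≋ 𝟎
  balanced-zero {v = v} β v≥0 sum≈0 vβ≈0 = nonneg-sum-zero v all≥0 sum≈0
    where
    all≥0 : ∀ α → 0# ≤ v α
    all≥0 α with α ≟ β
    ... | yes ≡.refl = ≤-reflexive (sym vβ≈0)
    ... | no α≢β     = v≥0 α α≢β

-- A bound on the dimension of a set of vectors, witnessed by linear functionals
-- whose common kernel meets the set only in zero.
module Rank (em : ExcludedMiddle 0ℓ) (R : CompleteOrderedField) where

  open ConvexGeometry R hiding (zero)
  open IntegerCoefficients R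
  open LinearFunctionals R
  open OrderedFieldProperties R

  private
    variable
      n : ℕ

  Rank≤ : ℕ → Pred (ℝ^ n) 0ℓ → Set
  Rank≤ zero    D = ∀ d → d ∈ D → d ≋ 𝟎
  Rank≤ (suc k) D = ∃[ f ] IsLinear f × Rank≤ k (λ d → d ∈ D × f d ≈ 0#)

  Rank≤-mono : ∀ k {D E : Pred (ℝ^ n) 0ℓ} → E ⊆ D → Rank≤ k D → Rank≤ k E
  Rank≤-mono zero    E⊆D r           = λ d → r d ∘ E⊆D
  Rank≤-mono (suc k) E⊆D (f , l , r) = f , l , Rank≤-mono k (λ (e , z) → E⊆D e , z) r

  Rank≤-functionals : ∀ k (f : Vector (ℝ^ n → ℝ) k) → (∀ i → IsLinear (f i)) →
    {D : Pred (ℝ^ n) 0ℓ} → (∀ d → d ∈ D → (∀ i → f i d ≈ 0#) → d ≋ 𝟎) → Rank≤ k D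
  Rank≤-functionals zero    f l h = λ d d∈D → h d d∈D λ ()
  Rank≤-functionals (suc k) f l h = f zero , l zero ,
    Rank≤-functionals k (tail f) (l ∘ suc)
      λ d (d∈D , f₀) fₛ → h d d∈D λ { zero → f₀ ; (suc i) → fₛ i }

  Rank≤-ℝ^ : (D : Pred (ℝ^ n) 0ℓ) → Rank≤ n D
  Rank≤-ℝ^ {n} D =
    Rank≤-functionals n (λ i v → v i) coordinate-isLinear λ _ _ e → e

  record IsSubspace (D : Pred (ℝ^ n) 0ℓ) : Set where
    field
      respects : D Respects _≋_
      +-closed : ∀ {u v} → u ∈ D → v ∈ D → u ⊕ v ∈ D
      *-closed : ∀ c {v} → v ∈ D → c ⊙ v ∈ D

  open IsSubspace

  ∩-ker : {D : Pred (ℝ^ n) 0ℓ} {f : ℝ^ n → ℝ} →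
          IsSubspace D → IsLinear f → IsSubspace (λ d → d ∈ D × f d ≈ 0#)
  ∩-ker D-sub f-linear = record
    { respects = λ e (d∈D , z) → respects D-sub e d∈D , trans (F.cong (sym ∘ e)) z
    ; +-closed = λ (d∈D , z) (e∈D , w) → +-closed D-sub d∈D e∈D ,
        trans (F.additive _ _) (trans (+-cong z w) (+-identityˡ 0#))
    ; *-closed = λ c (d∈D , z) → *-closed D-sub c d∈D ,
        trans (F.homogeneous c _) (trans (*-congˡ z) (zeroʳ c))
    }
    where module F = IsLinear f-linear

  -- If some e ∈ E lies outside the kernel of the first functional, then
  -- subtracting a multiple of e moves x into that kernel without entering E.
  Rank≤-proper : ∀ k {D E : Pred (ℝ^ n) 0ℓ} → IsSubspace D → IsSubspace E → E ⊆ D →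
    ∀ x → x ∈ D → x ∉ E → Rank≤ (suc k) D → Rank≤ k E
  Rank≤-proper {n} k {D} {E} D-sub E-sub E⊆D x x∈D x∉E (f , f-linear , r)
    with em {∃[ e ] e ∈ E × ¬ (f e ≈ 0#)}
  -- Here `E` lies inside the kernel of `f`, so the bound for `D` cut by that kernel applies to `E`
  -- directly.
  ... | no ∄e = Rank≤-mono k
        (λ {e} e∈E → E⊆D e∈E , em⇒dne em (λ fe≉0 → ∄e (e , e∈E , fe≉0))) r
  ... | yes (e , e∈E , fe≉0) = descend k r
    where
    module F = IsLinear f-linear
    c : ℝ
    c = f x * f e ⁻¹
    y : ℝ^ n
    y = (- c) ⊙ e ⊕ x
    y∈ : y ∈ D × f y ≈ 0#
    y∈ = +-closed D-sub (*-closed D-sub (- c) (E⊆D e∈E)) x∈D , (begin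
      f y                            ≈⟨ IsLinearProperties.affine f-linear (- c) e x ⟩
      - (f x * f e ⁻¹) * f e + f x   ≈⟨ solve 3 (λ a i b →
        :- (a :* i) :* b :+ a := a :* (con 1ℤ :- b :* i)) refl (f x) (f e ⁻¹) (f e) ⟩
      f x * (1# - f e * f e ⁻¹)      ≈⟨ *-congˡ (+-congˡ (-‿cong (⁻¹-inverseʳ _ fe≉0))) ⟩
      f x * (1# - 1#)                ≈⟨ *-congˡ (-‿inverseʳ 1#) ⟩
      f x * 0#                       ≈⟨ zeroʳ _ ⟩
      0#                             ∎)
      where open import Relation.Binary.Reasoning.Setoid setoid
    y∉E : y ∉ E
    y∉E y∈E = x∉E (respects E-sub
      (λ i → solve 3 (λ c e x → c :* e :+ (:- c :* e :+ x) := x) refl c (e i) (x i))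
      (+-closed E-sub (*-closed E-sub c e∈E) y∈E))
    descend : ∀ k → Rank≤ k (λ d → d ∈ D × f d ≈ 0#) → Rank≤ k E
    -- The kernel part of `D` is trivial, so `y` is zero and would belong to the subspace `E`.
    descend zero    r = contradiction
      (respects E-sub (λ i → trans (zeroˡ (e i)) (sym (r y y∈ i))) (*-closed E-sub 0# e∈E))
      y∉E
    -- `f` is kept for `E`; the functional to be saved is found inside the kernel, with `y` in the
    -- role of `x`.
    descend (suc k) r = f , f-linear , Rank≤-proper k (∩-ker D-sub f-linear)
      (∩-ker E-sub f-linear) (λ (d∈E , z) → E⊆D d∈E , z) y y∈ (y∉E ∘ proj₁) r

-- Minkowski's theorem for pointed intersections of halfspaces.

module Minkowski (em : ExcludedMiddle 0ℓ) (R : CompleteOrderedField) where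

  open ConvexGeometry R hiding (zero)
  open IntegerCoefficients R
  open LinearFunctionals R
  open OrderedFieldProperties R
  open Rank em R
  open import Relation.Binary.Reasoning.Setoid setoid

  -- The functional φ is positive on the nonzero vectors of the cone, so that it
  -- cuts out a bounded base.
  module ClosedCone {n : ℕ} {I : Set}
    (ℓ : I → ℝ^ n → ℝ) (ℓ-linear : ∀ i → IsLinear (ℓ i))
    (φ : ℝ^ n → ℝ) (φ-linear : IsLinear φ)
    (φ-nonneg : ∀ v → (∀ i → 0# ≤ ℓ i v) → 0# ≤ φ v)
    (φ-definite : ∀ v → (∀ i → 0# ≤ ℓ i v) → φ v ≈ 0# → v ≋ 𝟎)
    where

    private
      module ℓ {i} = IsLinear (ℓ-linear i)
      module ℓ′ {i} = IsLinearProperties (ℓ-linear i)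
      module φ = IsLinear φ-linear
      module φ′ = IsLinearProperties φ-linear

    K : Pred (ℝ^ n) 0ℓ
    K v = ∀ i → 0# ≤ ℓ i v

    K-respects : K Respects _≋_
    K-respects e v∈K i = nonneg-resp (ℓ.cong e) (v∈K i)

    K-⊕ : ∀ {u v} → u ∈ K → v ∈ K → u ⊕ v ∈ K
    K-⊕ u∈K v∈K i = nonneg-resp (sym (ℓ.additive _ _)) (+-nonneg (u∈K i) (v∈K i))

    K-⊙ : ∀ {c v} → 0# ≤ c → v ∈ K → c ⊙ v ∈ K
    K-⊙ c≥0 v∈K i = nonneg-resp (sym (ℓ.homogeneous _ _)) (*-nonneg c≥0 (v∈K i))

    -- The linear span of the smallest face of K containing p.
    FaceSpan : ℝ^ n → Pred (ℝ^ n) 0ℓ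
    FaceSpan p d = ∃[ C ] 0# ≤ C × C ⊙ p ⊕ d ∈ K × C ⊙ p ⊖ d ∈ K

    -- The smallest face containing `p` spans at most a line. Zero counts as well, since the cone is
    -- pointed, which spares a case in the decomposition.
    OnExtremeRay : Pred (ℝ^ n) 0ℓ
    OnExtremeRay p = ∀ d → d ∈ FaceSpan p → ∃[ c ] d ≋ c ⊙ p

    FaceSpan-⊝ : ∀ {p d} → d ∈ FaceSpan p → ⊝ d ∈ FaceSpan p
    FaceSpan-⊝ {p} {d} (C , C≥0 , d⁺ , d⁻) = C , C≥0 , d⁻ ,
      K-respects (λ i → solve 2 (λ x y → x :+ y := x :- (:- y)) refl ((C ⊙ p) i) (d i)) d⁺

    FaceSpan-respects : ∀ p → FaceSpan p Respects _≋_
    FaceSpan-respects p e (C , C≥0 , d⁺ , d⁻) = C , C≥0 ,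
      K-respects (λ i → +-congˡ (e i)) d⁺ ,
      K-respects (λ i → +-congˡ (-‿cong (e i))) d⁻

    FaceSpan-isSubspace : ∀ p → IsSubspace (FaceSpan p)
    FaceSpan-isSubspace p = record
      { respects = FaceSpan-respects p
      ; +-closed = λ {u} {v} (B , B≥0 , u⁺ , u⁻) (C , C≥0 , v⁺ , v⁻) →
          B + C , +-nonneg B≥0 C≥0 ,
          K-respects (λ i → solve 5 (λ B C p u v →
            (B :* p :+ u) :+ (C :* p :+ v) := (B :+ C) :* p :+ (u :+ v)) refl
            B C (p i) (u i) (v i)) (K-⊕ u⁺ v⁺) ,
          K-respects (λ i → solve 5 (λ B C p u v →
            (B :* p :- u) :+ (C :* p :- v) := (B :+ C) :* p :- (u :+ v)) refl
            B C (p i) (u i) (v i)) (K-⊕ u⁻ v⁻)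
      ; *-closed = *-closed′
      }
      where
      scale⁺ : ∀ {c d} → 0# ≤ c → d ∈ FaceSpan p → c ⊙ d ∈ FaceSpan p
      scale⁺ {c} {d} c≥0 (C , C≥0 , d⁺ , d⁻) = c * C , *-nonneg c≥0 C≥0 ,
        K-respects (λ i → solve 4 (λ c C p d →
          c :* (C :* p :+ d) := c :* C :* p :+ c :* d) refl c C (p i) (d i)) (K-⊙ c≥0 d⁺) ,
        K-respects (λ i → solve 4 (λ c C p d →
          c :* (C :* p :- d) := c :* C :* p :- c :* d) refl c C (p i) (d i)) (K-⊙ c≥0 d⁻)
      *-closed′ : ∀ c {d} → d ∈ FaceSpan p → c ⊙ d ∈ FaceSpan p
      *-closed′ c {d} d∈ with total 0# c
      ... | inj₁ c≥0 = scale⁺ c≥0 d∈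
      ... | inj₂ c≤0 = FaceSpan-respects p
        (λ i → solve 2 (λ c d → :- c :* :- d := c :* d) refl c (d i))
        (scale⁺ (neg-nonneg c≤0) (FaceSpan-⊝ d∈))

    p∈FaceSpan : ∀ {p} → p ∈ K → p ∈ FaceSpan p
    p∈FaceSpan {p} p∈K = 1# , proj₁ 0<1 ,
      K-respects (λ i → +-congʳ (sym (*-identityˡ (p i)))) (K-⊕ p∈K p∈K) ,
      K-respects (λ i → solve 1 (λ p → con (+ 0) :* p := con 1ℤ :* p :- p) refl (p i))
        (K-⊙ ≤-refl p∈K)

    -- Each constraint bounds `s` separately. If `ℓ i p` vanishes, the constraint does not involve
    -- `s` and holds because it holds at `C`; otherwise `- ℓ i d / ℓ i p` is an upper bound of the
    -- set and hence of its supremum. The sign of the parameter is reversed because completeness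
    -- provides suprema.
    K-closed : ∀ {p d C r} → p ∈ K → C ⊙ p ⊖ d ∈ K →
               IsSupremum (λ s → (- s) ⊙ p ⊖ d ∈ K) r → (- r) ⊙ p ⊖ d ∈ K
    K-closed {p} {d} {C} {r} p∈K Cp-d∈K r-sup i with em {ℓ i p ≈ 0#}
    ... | yes a≈0 = nonneg-resp (begin
        ℓ i (C ⊙ p ⊖ d)          ≈⟨ ℓ′.affine⁻ C p d ⟩
        C * ℓ i p - ℓ i d        ≈⟨ +-congʳ (*-congˡ a≈0) ⟩
        C * 0# - ℓ i d           ≈⟨ +-congʳ (solve 2 (λ C r →
          C :* con (+ 0) := :- r :* con (+ 0)) refl C r) ⟩
        - r * 0# - ℓ i d         ≈⟨ +-congʳ (*-congˡ a≈0) ⟨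
        - r * ℓ i p - ℓ i d      ≈⟨ ℓ′.affine⁻ (- r) p d ⟨
        ℓ i ((- r) ⊙ p ⊖ d)      ∎) (Cp-d∈K i)
    ... | no a≉0 = nonneg-resp (trans (rearrange r) (sym (ℓ′.affine⁻ (- r) p d)))
        (*-nonneg (p∈K i) (≤⇒0≤- (proj₂ r-sup (- ℓ i d * ℓ i p ⁻¹) λ s s∈S →
          0≤-⇒≤ (*-cancel-nonneg (p∈K i , a≉0 ∘ sym)
            (nonneg-resp (trans (ℓ′.affine⁻ (- s) p d) (sym (rearrange s))) (s∈S i))))))
      where
      rearrange : ∀ s → ℓ i p * (- ℓ i d * ℓ i p ⁻¹ - s) ≈ - s * ℓ i p - ℓ i d
      rearrange s = begin
        ℓ i p * (- ℓ i d * ℓ i p ⁻¹ - s)             ≈⟨ solve 4 (λ a b h s →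
          a :* (:- b :* h :- s) := :- s :* a :- (a :* h) :* b) refl
          (ℓ i p) (ℓ i d) (ℓ i p ⁻¹) s ⟩
        - s * ℓ i p - (ℓ i p * ℓ i p ⁻¹) * ℓ i d     ≈⟨ +-congˡ (-‿cong (trans
          (*-congʳ (⁻¹-inverseʳ _ a≉0)) (*-identityˡ _))) ⟩
        - s * ℓ i p - ℓ i d                          ∎

    OnExtremeRay-⊙ : ∀ {c p} → 0# < c → OnExtremeRay p → OnExtremeRay (c ⊙ p)
    OnExtremeRay-⊙ {c} {p} c>0 p-extreme d (C , C≥0 , d⁺ , d⁻)
      with b , d≋bp ← p-extreme d (C * c , *-nonneg C≥0 (proj₁ c>0) ,
        K-respects (λ i → +-congʳ (sym (*-assoc C c (p i)))) d⁺ ,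
        K-respects (λ i → +-congʳ (sym (*-assoc C c (p i)))) d⁻)
      = b * c ⁻¹ , λ i → begin
        d i                     ≈⟨ d≋bp i ⟩
        b * p i                 ≈⟨ *-identityˡ _ ⟨
        1# * (b * p i)          ≈⟨ *-congʳ (*⁻¹-inverse c>0) ⟨
        c * c ⁻¹ * (b * p i)    ≈⟨ solve 4 (λ c h b p →
          c :* h :* (b :* p) := b :* h :* (c :* p)) refl c (c ⁻¹) b (p i) ⟩
        b * c ⁻¹ * (c * p i)    ∎

    -- Up to the factor `t`, this is the point `p - d / t` at which the ray from `p` in direction
    -- `- d` leaves `K`. Minimising the coefficient of `p` maximises the step along `d` without a
    -- division.
    record Endpoint (p d : ℝ^ n) : Set where
      field
        t     : ℝ
        t>0   : 0# < t
        inK   : t ⊙ p ⊖ d ∈ K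
        least : ∀ s → s ⊙ p ⊖ d ∈ K → t ≤ s

    -- As `φ d` vanishes, `φ (t ⊙ p ⊖ d)` is `t * φ p`, so admissible `t` are nonnegative and have
    -- an infimum, attained by `K-closed`. It is not zero: otherwise `⊝ d` would lie in `K` with `φ`
    -- zero, and definiteness would give `d ≋ 𝟎`.
    endpoint : ∀ {p d} → p ∈ K → 0# < φ p → d ∈ FaceSpan p → φ d ≈ 0# → ¬ (d ≋ 𝟎) →
               Endpoint p d
    endpoint {p} {d} p∈K φp>0 (C , _ , _ , Cp-d∈K) φd≈0 d≉𝟎 = record
      { t     = - r
      ; t>0   = neg-nonneg (proj₂ r-sup 0# bounded) , λ 0≈t → d≉𝟎 (λ i → begin
          d i                   ≈⟨ solve 1 (λ x → x := :- (con (+ 0) :+ :- x)) refl (d i) ⟩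
          - (0# - d i)          ≈⟨ -‿cong (+-congʳ (zeroˡ (p i))) ⟨
          - (0# * p i - d i)    ≈⟨ -‿cong (+-congʳ (*-congʳ 0≈t)) ⟩
          - (- r * p i - d i)   ≈⟨ -‿cong (φ-definite _ inK (begin
              φ ((- r) ⊙ p ⊖ d)   ≈⟨ φ′.affine⁻ (- r) p d ⟩
              - r * φ p - φ d     ≈⟨ +-cong (*-congʳ (sym 0≈t)) (-‿cong φd≈0) ⟩
              0# * φ p - 0#       ≈⟨ solve 1 (λ a →
                con (+ 0) :* a :- con (+ 0) := con (+ 0)) refl (φ p) ⟩
              0#                  ∎) i) ⟩
          - 0#                  ≈⟨ solve 0 (:- con (+ 0) := con (+ 0)) refl ⟩
          0#                    ∎)
      ; inK   = inK
      ; least = λ s s∈ → 0≤-⇒≤ (nonneg-resp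
          (solve 2 (λ r s → r :- :- s := s :- :- r) refl r s)
          (≤⇒0≤- (proj₁ r-sup (- s) (negate-mem s∈))))
      }
      where
      S : Pred ℝ 0ℓ
      S r = (- r) ⊙ p ⊖ d ∈ K
      negate-mem : ∀ {s} → s ⊙ p ⊖ d ∈ K → S (- s)
      negate-mem {s} = K-respects λ i →
        solve 3 (λ s p d → s :* p :- d := :- (:- s) :* p :- d) refl s (p i) (d i)
      bounded : IsUpperBound S 0#
      bounded r r∈S = neg-nonneg⁻ (*-cancel-nonneg φp>0 (nonneg-resp (begin
        φ ((- r) ⊙ p ⊖ d)   ≈⟨ φ′.affine⁻ (- r) p d ⟩
        - r * φ p - φ d     ≈⟨ +-congˡ (-‿cong φd≈0) ⟩
        - r * φ p - 0#      ≈⟨ solve 2 (λ r a →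
          :- r :* a :- con (+ 0) := a :* :- r) refl r (φ p) ⟩
        φ p * - r           ∎) (φ-nonneg _ r∈S)))
      supremum : ∃ (IsSupremum S)
      supremum = complete S (- C , negate-mem Cp-d∈K) (0# , bounded)
      r : ℝ
      r = proj₁ supremum
      r-sup : IsSupremum S r
      r-sup = proj₂ supremum
      inK : (- r) ⊙ p ⊖ d ∈ K
      inK = K-closed p∈K Cp-d∈K r-sup

    module _ {p d : ℝ^ n} (e : Endpoint p d) where

      open Endpoint e

      -- The endpoint and `s ⊙ p ⊕ d` are elements of `K` with sum `(t + s) ⊙ p`, so the endpoint
      -- lies in the face of `p`.
      FaceSpan-endpoint⊆ : ∀ {s} → 0# ≤ s → s ⊙ p ⊕ d ∈ K →
                           FaceSpan (t ⊙ p ⊖ d) ⊆ FaceSpan p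
      FaceSpan-endpoint⊆ {s} s≥0 q′∈K {x} (C , C≥0 , x⁺ , x⁻) =
        C * (t + s) , *-nonneg C≥0 (+-nonneg (proj₁ t>0) s≥0) ,
        K-respects (λ i → solve 6 (λ C t s p d x →
          (C :* (t :* p :- d) :+ x) :+ C :* (s :* p :+ d) := C :* (t :+ s) :* p :+ x) refl
          C t s (p i) (d i) (x i)) (K-⊕ x⁺ (K-⊙ C≥0 q′∈K)) ,
        K-respects (λ i → solve 6 (λ C t s p d x →
          (C :* (t :* p :- d) :- x) :+ C :* (s :* p :+ d) := C :* (t :+ s) :* p :- x) refl
          C t s (p i) (d i) (x i)) (K-⊕ x⁻ (K-⊙ C≥0 q′∈K))

      -- If `C ⊙ (t ⊙ p ⊖ d) ⊖ d` were in `K`, division by `1# + C` would leave `d` with coefficient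
      -- -1 and `p` with `C t / (1 + C)`, which is below the least value `t`.
      d∉FaceSpan-endpoint : d ∉ FaceSpan (t ⊙ p ⊖ d)
      d∉FaceSpan-endpoint (C , C≥0 , _ , d⁻) =
        proj₂ t>0 (antisym (proj₁ t>0) (neg-nonneg⁻ (nonneg-resp (begin
          (1# + C) * (h * C * t - t)         ≈⟨ solve 3 (λ C h t →
            (con 1ℤ :+ C) :* (h :* C :* t :- t) :=
            ((con 1ℤ :+ C) :* h) :* (C :* t) :- (con 1ℤ :+ C) :* t) refl C h t ⟩
          (1# + C) * h * (C * t) - (1# + C) * t   ≈⟨ +-congʳ (*-congʳ inverse) ⟩
          1# * (C * t) - (1# + C) * t        ≈⟨ solve 2 (λ C t →
            con 1ℤ :* (C :* t) :- (con 1ℤ :+ C) :* t := :- t) refl C t ⟩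
          - t                                ∎)
          (*-nonneg (proj₁ 1+C>0) (≤⇒0≤- (least (h * C * t) smaller))))))
        where
        1+C>0 : 0# < 1# + C
        1+C>0 = +-pos-nonneg 0<1 C≥0
        h : ℝ
        h = (1# + C) ⁻¹
        inverse : (1# + C) * h ≈ 1#
        inverse = *⁻¹-inverse 1+C>0
        smaller : (h * C * t) ⊙ p ⊖ d ∈ K
        smaller = K-respects (λ i → begin
          h * (C * (t * p i - d i) - d i)              ≈⟨ solve 5 (λ h C t p d →
            h :* (C :* (t :* p :- d) :- d) :=
            h :* C :* t :* p :- ((con 1ℤ :+ C) :* h) :* d) refl h C t (p i) (d i) ⟩
          h * C * t * p i - (1# + C) * h * d i         ≈⟨ +-congˡ (-‿cong (trans
            (*-congʳ inverse) (*-identityˡ (d i)))) ⟩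
          h * C * t * p i - d i                        ∎) (K-⊙ (proj₁ (⁻¹-pos 1+C>0)) d⁻)

    -- Minkowski's theorem as an induction principle. The free level `a` admits the circuit graph,
    -- whose generators quantify over convex cones and so live one level up.
    module Generation {a : Level} (G : Pred (ℝ^ n) a) (G-respects : G Respects _≋_)
      (G-⊕ : ∀ {u v} → u ∈ G → v ∈ G → u ⊕ v ∈ G)
      (G-⊙ : ∀ {c v} → 0# ≤ c → v ∈ G → c ⊙ v ∈ G)
      (G-extreme : ∀ {p} → p ∈ K → OnExtremeRay p → p ∈ G) where

      -- A point not on an extreme ray lies strictly between two endpoints of a
      -- segment in a level set of φ, and each endpoint has a smaller face span.
      generated : ∀ k p → p ∈ K → Rank≤ k (FaceSpan p) → p ∈ G
      generated k p p∈K r with em {∃[ d ] d ∈ FaceSpan p × ¬ (∃[ c ] d ≋ c ⊙ p)}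
      ... | no ∄d = G-extreme p∈K λ d d∈ → em⇒dne em λ ∄c → ∄d (d , d∈ , ∄c)
      ... | yes (d , d∈ , ∄c) = descend k r
        where
        -- Otherwise `p` is zero, so `φ` takes the values `φ d` and `- φ d` on two elements of `K`;
        -- both are nonnegative, hence zero, and `d` is zero, a multiple of `p`.
        φp≉0 : ¬ (φ p ≈ 0#)
        φp≉0 φp≈0 = ∄c (0# , λ i → begin
            d i                  ≈⟨ solve 2 (λ x d → d := (x :+ d) :- x) refl (C * p i) (d i) ⟩
            (C * p i + d i) - C * p i   ≈⟨ +-cong (φ-definite _ C⁺ φC⁺≈0 i)
              (-‿cong (*-congˡ (φ-definite p p∈K φp≈0 i))) ⟩
            0# - C * 0#          ≈⟨ solve 2 (λ C p →
              con (+ 0) :- C :* con (+ 0) := con (+ 0) :* p) refl C (p i) ⟩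
            0# * p i             ∎)
          where
          C = proj₁ d∈
          C⁺ = proj₁ (proj₂ (proj₂ d∈))
          C⁻ = proj₂ (proj₂ (proj₂ d∈))
          Cφp≈0 : C * φ p ≈ 0#
          Cφp≈0 = trans (*-congˡ φp≈0) (zeroʳ C)
          φC⁺ : φ (C ⊙ p ⊕ d) ≈ φ d
          φC⁺ = trans (φ′.affine C p d) (trans (+-congʳ Cφp≈0) (+-identityˡ _))
          φC⁻ : φ (C ⊙ p ⊖ d) ≈ - φ d
          φC⁻ = trans (φ′.affine⁻ C p d) (trans (+-congʳ Cφp≈0) (+-identityˡ _))
          φC⁺≈0 : φ (C ⊙ p ⊕ d) ≈ 0#
          φC⁺≈0 = trans φC⁺ (nonneg-antisym
            (nonneg-resp φC⁺ (φ-nonneg _ C⁺)) (nonneg-resp φC⁻ (φ-nonneg _ C⁻)))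
        φp>0 : 0# < φ p
        φp>0 = φ-nonneg p p∈K , φp≉0 ∘ sym
        -- Subtracting the multiple of `p` with the same `φ`-value puts the direction into the
        -- kernel of `φ`, as `endpoint` requires.
        c : ℝ
        c = - (φ d * φ p ⁻¹)
        e : ℝ^ n
        e = c ⊙ p ⊕ d
        open IsSubspace (FaceSpan-isSubspace p)
        e∈ : e ∈ FaceSpan p
        e∈ = +-closed (*-closed c (p∈FaceSpan p∈K)) d∈
        φe≈0 : φ e ≈ 0#
        φe≈0 = begin
          φ e                            ≈⟨ φ′.affine c p d ⟩
          - (φ d * φ p ⁻¹) * φ p + φ d   ≈⟨ solve 3 (λ a i b →
            :- (a :* i) :* b :+ a := a :* (con 1ℤ :- b :* i)) refl (φ d) (φ p ⁻¹) (φ p) ⟩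
          φ d * (1# - φ p * φ p ⁻¹)      ≈⟨ *-congˡ (+-congˡ (-‿cong (⁻¹-inverseʳ _ φp≉0))) ⟩
          φ d * (1# - 1#)                ≈⟨ *-congˡ (-‿inverseʳ 1#) ⟩
          φ d * 0#                       ≈⟨ zeroʳ _ ⟩
          0#                             ∎
        e≉𝟎 : ¬ (e ≋ 𝟎)
        e≉𝟎 e≋𝟎 = ∄c (- c , λ i → begin
          d i                           ≈⟨ solve 3 (λ c p d →
            d := (c :* p :+ d) :+ :- c :* p) refl c (p i) (d i) ⟩
          e i + - c * p i               ≈⟨ +-congʳ (e≋𝟎 i) ⟩
          0# + - c * p i                ≈⟨ +-identityˡ _ ⟩
          - c * p i                     ∎)
        ⊝-involutive : ∀ i → - - e i ≈ e i
        ⊝-involutive i = solve 1 (λ x → :- :- x := x) refl (e i)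
        E E′ : Endpoint p _
        E  = endpoint p∈K φp>0 e∈ φe≈0 e≉𝟎
        E′ = endpoint p∈K φp>0 (FaceSpan-⊝ e∈)
          (trans (φ′.negative e) (trans (-‿cong φe≈0) (solve 0 (:- con (+ 0) := con (+ 0)) refl)))
          (λ ⊝e≋𝟎 → e≉𝟎 λ i → trans (sym (⊝-involutive i))
            (trans (-‿cong (⊝e≋𝟎 i)) (solve 0 (:- con (+ 0) := con (+ 0)) refl)))
        module E = Endpoint E
        module E′ = Endpoint E′
        t+t′>0 : 0# < E.t + E′.t
        t+t′>0 = +-pos-nonneg E.t>0 (proj₁ E′.t>0)
        descend : ∀ k → Rank≤ k (FaceSpan p) → p ∈ G
        descend zero    r = contradiction (r e e∈) e≉𝟎
        -- The endpoints for `e` and `⊝ e` add up to `(E.t + E′.t) ⊙ p`.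
        descend (suc k) r = G-respects
          (λ i → trans (solve 5 (λ h t s p e →
              h :* ((t :* p :- e) :+ (s :* p :- :- e)) := ((t :+ s) :* h) :* p) refl
              ((E.t + E′.t) ⁻¹) E.t E′.t (p i) (e i))
            (trans (*-congʳ (*⁻¹-inverse t+t′>0)) (*-identityˡ (p i))))
          (G-⊙ (proj₁ (⁻¹-pos t+t′>0)) (G-⊕
            (generated k _ E.inK (Rank≤-proper k (FaceSpan-isSubspace p) (FaceSpan-isSubspace _)
              (FaceSpan-endpoint⊆ E (proj₁ E′.t>0)
                (K-respects (λ i → +-congˡ (⊝-involutive i)) E′.inK))
              e e∈ (d∉FaceSpan-endpoint E) r))
            (generated k _ E′.inK (Rank≤-proper k (FaceSpan-isSubspace p) (FaceSpan-isSubspace _)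
              (FaceSpan-endpoint⊆ E′ (proj₁ E.t>0) E.inK)
              (⊝ e) (FaceSpan-⊝ e∈) (d∉FaceSpan-endpoint E′) r))))

      K⊆G : K ⊆ G
      K⊆G {p} p∈K = generated n p p∈K (Rank≤-ℝ^ (FaceSpan p))

-- Closure properties of conic hulls.

module ConicHullProperties (R : CompleteOrderedField)
  {a : Level} {m : ℕ} (S : Pred (ConvexGeometry.Extended R m) a) where

  open ConvexGeometry R hiding (zero)
  open LinearFunctionals R
  open OrderedFieldProperties R

  conicHull-respects : conicHull S Respects _≋ₑ_
  conicHull-respects (y≋ , s≈) (k , c , v , t , c≥0 , ∈S , y≋′ , s≈′) =
    k , c , v , t , c≥0 , ∈S , (λ j → trans (sym (y≋ j)) (y≋′ j)) , trans (sym s≈) s≈′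

  𝟎∈conicHull : 𝟎ₑ ∈ conicHull S
  𝟎∈conicHull = 0 , [] , [] , [] , (λ ()) , (λ ()) , (λ _ → refl) , refl

  conicHull-step : ∀ {c p q} → 0# ≤ c → p ∈ S → q ∈ conicHull S →
                   c ⊙ₑ p ⊕ₑ q ∈ conicHull S
  conicHull-step c≥0 p∈S (k , cs , v , t , cs≥0 , ∈S , y≋ , s≈) =
    suc k , _ ∷ cs , _ ∷ v , _ ∷ t ,
    (λ { zero → c≥0 ; (suc i) → cs≥0 i }) ,
    (λ { zero → p∈S ; (suc i) → ∈S i }) ,
    (λ j → +-congˡ (y≋ j)) , +-congˡ s≈

  -- Prepending the terms of one combination to the other singly avoids sums over concatenated
  -- families.
  conicHull-⊕ : ∀ {p q} → p ∈ conicHull S → q ∈ conicHull S → p ⊕ₑ q ∈ conicHull S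
  conicHull-⊕ {q = q} (k , c , v , t , c≥0 , ∈S , y≋ , s≈) q∈ =
    conicHull-respects ((λ j → +-congʳ (sym (y≋ j))) , +-congʳ (sym s≈))
      (prepend k c v t c≥0 ∈S)
    where
    prepend : ∀ k c v t → (∀ i → 0# ≤ c i) → (∀ i → (v i , t i) ∈ S) →
              (combination {k} c v , c ∙ t) ⊕ₑ q ∈ conicHull S
    prepend zero    c v t c≥0 ∈S =
      conicHull-respects ((λ j → sym (+-identityˡ _)) , sym (+-identityˡ _)) q∈
    prepend (suc k) c v t c≥0 ∈S =
      conicHull-respects ((λ j → sym (+-assoc _ _ _)) , sym (+-assoc _ _ _))
        (conicHull-step (c≥0 zero) (∈S zero)
          (prepend k (tail c) (tail v) (tail t) (c≥0 ∘ suc) (∈S ∘ suc)))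

  conicHull-⊙ : ∀ {r p} → 0# ≤ r → p ∈ conicHull S → r ⊙ₑ p ∈ conicHull S
  conicHull-⊙ {r = r} r≥0 (k , c , v , t , c≥0 , ∈S , y≋ , s≈) =
    k , r ⊙ c , v , t , (λ i → *-nonneg r≥0 (c≥0 i)) , ∈S ,
    (λ j → trans (*-congˡ (y≋ j))
      (sym (IsLinear.homogeneous (combination-isLinear v j) r c))) ,
    trans (*-congˡ s≈) (sym (IsLinear.homogeneous (∙-isLinearˡ t) r c))

-- The cone { (ν , τ) : ν ∈ N β , σ_X(-𝒜ν) ≤ τ }, with τ stored at index zero.
-- It is an intersection of halfspaces, one for each x ∈ X and finitely many for
-- N β, and its extreme rays are spanned by circuits and by (𝟎 , 1).
module CircuitCone (em : ExcludedMiddle 0ℓ) (R : CompleteOrderedField)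
  {n m : ℕ} (X : Pred (ConvexGeometry.ℝ^ R n) 0ℓ) (X-nonempty : Satisfiable X)
  (𝒜 : Vector (ConvexGeometry.ℝ^ R n) m) (β : Fin m) where

  open ConvexGeometry R hiding (zero)
  open IntegerCoefficients R
  open LinearFunctionals R
  open OrderedFieldProperties R
  open Minkowski em R
  open SublinearCircuits X 𝒜
  open ConicHullProperties R circuitGenerators
  open import Relation.Binary.Reasoning.Setoid setoid

  -- The margin in the inequality between the value of `⊝ 𝒜[ ν ]` at `x` and the stored bound.
  slack : ℝ^ n → ℝ^ (suc m) → ℝ
  slack x p = p zero + 𝒜[ tail p ] ∙ x

  data Constraint : Set where
    coordinate  : ∀ α → ¬ (α ≡ β) → Constraint
    sum≥0 sum≤0 : Constraint
    point       : ∀ x → x ∈ X → Constraint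

  ℓ : Constraint → ℝ^ (suc m) → ℝ
  ℓ (coordinate α _) p = p (suc α)
  ℓ sum≥0            p = sum (tail p)
  ℓ sum≤0            p = - sum (tail p)
  ℓ (point x _)      p = slack x p

  𝒜∙-isLinear : ∀ x → IsLinear (λ ν → 𝒜[ ν ] ∙ x)
  𝒜∙-isLinear x = ∘-isLinear (combination-isLinear 𝒜) (∙-isLinearˡ x)

  tail-isLinear : {f : ℝ^ m → ℝ} → IsLinear f → IsLinear (λ p → f (tail p))
  tail-isLinear = ∘-isLinear (λ j → coordinate-isLinear (suc j))

  slack-isLinear : ∀ x → IsLinear (slack x)
  slack-isLinear x = +-isLinear (coordinate-isLinear zero) (tail-isLinear (𝒜∙-isLinear x))

  ℓ-isLinear : ∀ i → IsLinear (ℓ i)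
  ℓ-isLinear (coordinate α _) = coordinate-isLinear (suc α)
  ℓ-isLinear sum≥0            = tail-isLinear sum-isLinear
  ℓ-isLinear sum≤0            = neg-isLinear (tail-isLinear sum-isLinear)
  ℓ-isLinear (point x _)      = slack-isLinear x

  constraints⇒N : ∀ {p} → (∀ i → 0# ≤ ℓ i p) → tail p ∈ N β
  constraints⇒N h = (λ α α≢β → h (coordinate α α≢β)) , nonneg-antisym (h sum≥0) (h sum≤0)

  x₀ : ℝ^ n
  x₀ = proj₁ X-nonempty

  -- A sum of two functionals nonnegative on the cone. When both vanish, the first forces the vector
  -- part to be zero, and then the slack at `x₀` is the remaining coordinate.
  φ : ℝ^ (suc m) → ℝ
  φ p = - p (suc β) + slack x₀ p

  φ-isLinear : IsLinear φ
  φ-isLinear = +-isLinear (neg-isLinear (coordinate-isLinear (suc β))) (slack-isLinear x₀)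

  slack-zero : ∀ x p → tail p ≋ 𝟎 → slack x p ≈ p zero
  slack-zero x p ν≋𝟎 = trans
    (+-congˡ (IsLinearProperties.vanishes (𝒜∙-isLinear x) ν≋𝟎)) (+-identityʳ (p zero))

  φ-nonneg : ∀ p → (∀ i → 0# ≤ ℓ i p) → 0# ≤ φ p
  φ-nonneg p h =
    +-nonneg (balanced-nonpos β (proj₁ (constraints⇒N h)) (proj₂ (constraints⇒N h)))
      (h (point _ (proj₂ X-nonempty)))

  φ-definite : ∀ p → (∀ i → 0# ≤ ℓ i p) → φ p ≈ 0# → p ≋ 𝟎
  φ-definite p h φp≈0 = λ { zero → p₀≈0 ; (suc α) → ν≋𝟎 α }
    where
    -β≥0 : 0# ≤ - p (suc β)
    -β≥0 = balanced-nonpos β (proj₁ (constraints⇒N h)) (proj₂ (constraints⇒N h))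
    slack≥0 : 0# ≤ slack x₀ p
    slack≥0 = h (point _ (proj₂ X-nonempty))
    ν≋𝟎 : tail p ≋ 𝟎
    ν≋𝟎 = balanced-zero β (proj₁ (constraints⇒N h)) (proj₂ (constraints⇒N h))
      (nonneg-antisym (nonneg-resp (begin
          slack x₀ p                          ≈⟨ solve 2 (λ s b →
            s := (:- b :+ s) :+ b) refl (slack x₀ p) (p (suc β)) ⟩
          φ p + p (suc β)                     ≈⟨ +-congʳ φp≈0 ⟩
          0# + p (suc β)                      ≈⟨ +-identityˡ _ ⟩
          p (suc β)                           ∎) slack≥0) -β≥0)
    p₀≈0 : p zero ≈ 0#
    p₀≈0 = begin
      p zero                   ≈⟨ slack-zero x₀ p ν≋𝟎 ⟨
      slack x₀ p               ≈⟨ solve 1 (λ s → s := :- con (+ 0) :+ s) refl (slack x₀ p) ⟩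
      - 0# + slack x₀ p        ≈⟨ +-congʳ (-‿cong (ν≋𝟎 β)) ⟨
      φ p                      ≈⟨ φp≈0 ⟩
      0#                       ∎

  open ClosedCone ℓ ℓ-isLinear φ φ-isLinear φ-nonneg φ-definite public

  inCone : ∀ {p} → tail p ∈ N β → (∀ x → x ∈ X → 0# ≤ slack x p) → p ∈ K
  inCone (ν≥0 , _)   _ (coordinate α α≢β) = ν≥0 α α≢β
  inCone (_ , sum≈0) _ sum≥0              = ≤-reflexive (sym sum≈0)
  inCone (_ , sum≈0) _ sum≤0              = neg-nonneg (≤-reflexive sum≈0)
  inCone _           h (point x x∈X)      = h x x∈X

  minus-⊝ : ∀ s ν x → s - (⊝ 𝒜[ ν ]) ∙ x ≈ s + 𝒜[ ν ] ∙ x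
  minus-⊝ s ν x = trans
    (+-congˡ (-‿cong (IsLinearProperties.negative (∙-isLinearˡ x) 𝒜[ ν ])))
    (solve 2 (λ s a → s :- :- a := s :+ a) refl s (𝒜[ ν ] ∙ x))

  supportBound⇒slack : ∀ {ν s} → IsUpperBound (λ v → ∃[ x ] x ∈ X × v ≈ (⊝ 𝒜[ ν ]) ∙ x) s →
                       ∀ x → x ∈ X → 0# ≤ s + 𝒜[ ν ] ∙ x
  supportBound⇒slack {ν} {s} h x x∈X =
    nonneg-resp (minus-⊝ s ν x) (≤⇒0≤- (h _ (x , x∈X , refl)))

  slack⇒supportBound : ∀ {ν s} → (∀ x → x ∈ X → 0# ≤ s + 𝒜[ ν ] ∙ x) →
                       IsUpperBound (λ v → ∃[ x ] x ∈ X × v ≈ (⊝ 𝒜[ ν ]) ∙ x) s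
  slack⇒supportBound {ν} {s} h v (x , x∈X , v≈) = 0≤-⇒≤ (nonneg-resp
    (trans (sym (minus-⊝ s ν x)) (+-congˡ (-‿cong (sym v≈)))) (h x x∈X))

  -- Extreme rays with nonzero vector part are circuits.

  module _ {p : ℝ^ (suc m)} (p∈K : p ∈ K) (p-extreme : OnExtremeRay p)
    (ν≉𝟎 : ¬ (tail p ≋ 𝟎)) where

    private
      ν : ℝ^ m
      ν = tail p

    -- A smaller bound `b` would split `p` into `b ∷ ν` and a positive vertical vector, both in the
    -- cone. The vertical vector would then be a nonzero multiple of `p`, which forces `ν` to be
    -- zero.
    extreme⇒least : ∀ b → IsUpperBound (λ v → ∃[ x ] x ∈ X × v ≈ (⊝ 𝒜[ ν ]) ∙ x) b →
                    p zero ≤ b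
    extreme⇒least b b-bound = em⇒dne em λ p₀≰b → vertical (≰⇒> p₀≰b)
      where
      vertical : ¬ (b < p zero)
      vertical b<p₀ = ν≉𝟎 λ α → *-cancel-zero c≉0 (sym (d≋cp (suc α)))
        where
        ε : ℝ
        ε = p zero - b
        ε>0 : 0# < ε
        ε>0 = <⇒0<- b<p₀
        d : ℝ^ (suc m)
        d = ε ∷ 𝟎
        d∈K : d ∈ K
        d∈K = inCone
          ((λ _ _ → ≤-refl) , IsLinearProperties.vanishes (sum-isLinear {m}) {𝟎} (λ _ → refl))
          (λ x _ → nonneg-resp (sym (slack-zero x d (λ _ → refl))) (proj₁ ε>0))
        p-d∈K : 1# ⊙ p ⊖ d ∈ K
        p-d∈K = K-respects
          (λ { zero    → solve 2 (λ b p → b := con 1ℤ :* p :- (p :- b)) refl b (p zero)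
             ; (suc α) → solve 1 (λ x → x := con 1ℤ :* x :- con (+ 0)) refl (ν α) })
          (inCone {b ∷ ν} (constraints⇒N p∈K) (supportBound⇒slack b-bound))
        multiple : ∃[ c ] d ≋ c ⊙ p
        multiple = p-extreme d (1# , proj₁ 0<1 , K-⊕ (K-⊙ (proj₁ 0<1) p∈K) d∈K , p-d∈K)
        c : ℝ
        c = proj₁ multiple
        d≋cp : d ≋ c ⊙ p
        d≋cp = proj₂ multiple
        c≉0 : ¬ (c ≈ 0#)
        c≉0 c≈0 = proj₂ ε>0 (sym (trans (d≋cp zero) (trans (*-congʳ c≈0) (zeroˡ _))))

    extreme⇒support : σ[-𝒜 ν ]≈ p zero
    extreme⇒support =
      slack⇒supportBound (λ x x∈X → p∈K (point x x∈X)) , extreme⇒least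

    -- Along any direction `e` of the affine hull of `C`, small steps both ways stay in `C`, and `f`
    -- lifts them to points of the cone. So a multiple of `f e ∷ e` lies in the face span of `p`,
    -- and `e` is a multiple of `ν`; two independent directions cannot both be.
    extreme⇒minimal : ∀ (C : Pred (ℝ^ m) 0ℓ) → HasDimension 2 C → C ⊆ N β →
                      σ-LinearOn C → ν ∉ relativeInterior C
    extreme⇒minimal C (o , b , b-independent , aff) C⊆N (f , f-linear , f-support)
      (ν∈C , ε , ε>0 , ball) = 0≉1 (sym (b-independent g₁ g₁-trivial (suc zero)))
      where
      module f = IsLinear f-linear

      ν∈aff : ν ∈ affineHull C
      ν∈aff = 1 , (λ _ → 1#) , (λ _ → ν) , (λ _ → ν∈C) , +-identityʳ 1# ,
        λ j → solve 1 (λ x → x := con 1ℤ :* x :+ con (+ 0)) refl (ν j)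

      c₀ : ℝ^ 2
      c₀ = proj₁ (Equivalence.to (aff ν) ν∈aff)
      ν≋ : ν ≋ o ⊕ combination c₀ b
      ν≋ = proj₂ (Equivalence.to (aff ν) ν∈aff)

      p₀≈fν : p zero ≈ f ν
      p₀≈fν = antisym (proj₂ extreme⇒support _ (proj₁ (f-support ν ν∈C)))
                      (proj₂ (f-support ν ν∈C) _ (proj₁ extreme⇒support))

      module _ (g : ℝ^ 2) where

        e : ℝ^ m
        e = combination g b
        -- Dividing by `1# + B` keeps the squared step length `t * t * B` below `ε * ε` without a
        -- square root, also when `e` is zero.
        B t : ℝ
        B = e ∙ e
        t = ε * (1# + B) ⁻¹
        B≥0 : 0# ≤ B
        B≥0 = sum-nonneg _ (λ i → square-nonneg (e i))
        1+B>0 : 0# < 1# + B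
        1+B>0 = +-pos-nonneg 0<1 B≥0
        t>0 : 0# < t
        t>0 = *-pos ε>0 (⁻¹-pos 1+B>0)
        ε≈ : ε ≈ t * (1# + B)
        ε≈ = sym (trans
          (solve 3 (λ ε h c → (ε :* h) :* c := ε :* (c :* h)) refl ε ((1# + B) ⁻¹) (1# + B))
          (trans (*-congˡ (*⁻¹-inverse 1+B>0)) (*-identityʳ ε)))

        -- The condition on squares covers both signs, `t` and `- t`, at once.
        perturbed∈C : ∀ s → s * s ≈ t * t → ν ⊕ s ⊙ e ∈ C
        perturbed∈C s s²≈t² = ball _
          (Equivalence.from (aff _) (c₀ ⊕ s ⊙ g , λ j → begin
            ν j + s * e j                                  ≈⟨ +-congʳ (ν≋ j) ⟩
            (o j + combination c₀ b j) + s * e j           ≈⟨ +-assoc _ _ _ ⟩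
            o j + (combination c₀ b j + s * e j)           ≈⟨ +-congˡ (+-congˡ
              (IsLinear.homogeneous (combination-isLinear b j) s g)) ⟨
            o j + (combination c₀ b j + combination (s ⊙ g) b j)   ≈⟨ +-congˡ
              (IsLinear.additive (combination-isLinear b j) c₀ (s ⊙ g)) ⟨
            o j + combination (c₀ ⊕ s ⊙ g) b j             ∎))
          (<-resp₂ (sym norm) refl (0<-⇒< (<-resp₂ refl (sym gap)
            (*-pos (*-pos t>0 t>0) (+-pos-nonneg 1+B>0 (square-nonneg B))))))
          where
          norm : (ν ⊕ s ⊙ e ⊖ ν) ∙ (ν ⊕ s ⊙ e ⊖ ν) ≈ t * t * B
          norm = begin
            (ν ⊕ s ⊙ e ⊖ ν) ∙ (ν ⊕ s ⊙ e ⊖ ν)   ≈⟨ sum-cong-≋ (λ i → solve 3 (λ v s e →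
              ((v :+ s :* e) :- v) :* ((v :+ s :* e) :- v) := (s :* s) :* (e :* e)) refl
              (ν i) s (e i)) ⟩
            sum (λ i → (s * s) * (e i * e i))     ≈⟨ *-distribˡ-sum (s * s) (λ i → e i * e i) ⟨
            s * s * B                             ≈⟨ *-congʳ s²≈t² ⟩
            t * t * B                             ∎
          gap : ε * ε - t * t * B ≈ t * t * ((1# + B) + B * B)
          gap = trans (+-congʳ (*-cong ε≈ ε≈)) (solve 2 (λ t B →
            (t :* (con 1ℤ :+ B)) :* (t :* (con 1ℤ :+ B)) :- t :* t :* B :=
            t :* t :* ((con 1ℤ :+ B) :+ B :* B)) refl t B)

        lifted∈K : ∀ s → s * s ≈ t * t → 1# ⊙ p ⊕ s ⊙ (f e ∷ e) ∈ K
        lifted∈K s s²≈t² = K-respects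
          (λ { zero    → begin
                 f (ν ⊕ s ⊙ e)           ≈⟨ f.additive ν (s ⊙ e) ⟩
                 f ν + f (s ⊙ e)         ≈⟨ +-congˡ (f.homogeneous s e) ⟩
                 f ν + s * f e           ≈⟨ +-congʳ p₀≈fν ⟨
                 p zero + s * f e        ≈⟨ +-congʳ (*-identityˡ _) ⟨
                 1# * p zero + s * f e   ∎
             ; (suc α) → +-congʳ (sym (*-identityˡ (ν α))) })
          (inCone {f (ν ⊕ s ⊙ e) ∷ ν ⊕ s ⊙ e} (C⊆N y∈C)
            (supportBound⇒slack (proj₁ (f-support _ y∈C))))
          where
          y∈C : ν ⊕ s ⊙ e ∈ C
          y∈C = perturbed∈C s s²≈t²

        direction : ℝ^ (suc m)
        direction = t ⊙ (f e ∷ e)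

        direction∈ : direction ∈ FaceSpan p
        direction∈ = 1# , proj₁ 0<1 , lifted∈K t refl ,
          K-respects
            (λ i → +-congˡ (solve 2 (λ t x → :- t :* x := :- (t :* x)) refl t ((f e ∷ e) i)))
            (lifted∈K (- t) (solve 1 (λ t → :- t :* :- t := t :* t) refl t))

        multiple : ∃[ c ] direction ≋ c ⊙ p
        multiple = p-extreme direction direction∈

        collinear : ∃[ r ] e ≋ r ⊙ ν
        collinear = t ⁻¹ * proj₁ multiple , λ j → begin
          e j                              ≈⟨ *-identityˡ (e j) ⟨
          1# * e j                         ≈⟨ *-congʳ (*⁻¹-inverse t>0) ⟨
          t * t ⁻¹ * e j                   ≈⟨ solve 3 (λ t i e → t :* i :* e := i :* (t :* e)) refl
            t (t ⁻¹) (e j) ⟩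
          t ⁻¹ * (t * e j)                 ≈⟨ *-congˡ (proj₂ multiple (suc j)) ⟩
          t ⁻¹ * (proj₁ multiple * ν j)    ≈⟨ *-assoc _ _ _ ⟨
          t ⁻¹ * proj₁ multiple * ν j      ∎

      -- The basis directions are `r₀ ⊙ ν` and `r₁ ⊙ ν`, so `w` combines them to zero. Independence
      -- gives `r₁ ≈ 0#`; hence the second basis vector is zero, against independence again.
      g₀ g₁ w : ℝ^ 2
      g₀ = 1# ∷ 0# ∷ []
      g₁ = 0# ∷ 1# ∷ []
      r₀ r₁ : ℝ
      r₀ = proj₁ (collinear g₀)
      r₁ = proj₁ (collinear g₁)
      w = r₁ ⊙ g₀ ⊖ r₀ ⊙ g₁

      w-trivial : combination w b ≋ 𝟎
      w-trivial j = begin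
        combination w b j                                  ≈⟨ L.affine⁻ r₁ g₀ (r₀ ⊙ g₁) ⟩
        r₁ * e g₀ j - combination (r₀ ⊙ g₁) b j            ≈⟨ +-cong (*-congˡ (proj₂ (collinear g₀) j))
          (-‿cong (trans (IsLinear.homogeneous (combination-isLinear b j) r₀ g₁)
            (*-congˡ (proj₂ (collinear g₁) j)))) ⟩
        r₁ * (r₀ * ν j) - r₀ * (r₁ * ν j)                  ≈⟨ solve 3 (λ a b v →
          a :* (b :* v) :- b :* (a :* v) := con (+ 0)) refl r₁ r₀ (ν j) ⟩
        0#                                                 ∎
        where module L = IsLinearProperties (combination-isLinear b j)

      r₁≈0 : r₁ ≈ 0#
      r₁≈0 = trans
        (solve 2 (λ a b → a := a :* con 1ℤ :- b :* con (+ 0)) refl r₁ r₀)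
        (b-independent w w-trivial zero)

      g₁-trivial : combination g₁ b ≋ 𝟎
      g₁-trivial j = trans (proj₂ (collinear g₁) j) (trans (*-congʳ r₁≈0) (zeroˡ _))

    extreme⇒circuit : IsCircuit β ν
    extreme⇒circuit = record
      { nonzero = ν≉𝟎
      ; member  = constraints⇒N p∈K
      ; finite  = p zero , extreme⇒support
      ; minimal = λ C _ → extreme⇒minimal C
      }

  -- The cone lies in the circuit graph.

  InCircuitGraph : Pred (ℝ^ (suc m)) (lsuc 0ℓ)
  InCircuitGraph p = circuitGraph (tail p , p zero)

  extreme⇒inCircuitGraph : ∀ {p} → p ∈ K → OnExtremeRay p → p ∈ InCircuitGraph
  extreme⇒inCircuitGraph {p} p∈K p-extreme with em {tail p ≋ 𝟎}
  ... | yes ν≋𝟎 = conicHull-respects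
        ((λ α → trans (solve 1 (λ c → c :* con (+ 0) :+ con (+ 0) := con (+ 0)) refl (p zero))
            (sym (ν≋𝟎 α))) ,
          solve 1 (λ c → c :* con 1ℤ :+ con (+ 0) := c) refl (p zero))
        (conicHull-step p₀≥0 (inj₂ ((λ _ → refl) , refl)) 𝟎∈conicHull)
    where
    p₀≥0 : 0# ≤ p zero
    p₀≥0 = nonneg-resp (slack-zero x₀ p ν≋𝟎) (p∈K (point x₀ (proj₂ X-nonempty)))
  ... | no ν≉𝟎 = conicHull-respects
        ((λ α → rescale (suc α)) , rescale zero)
        (conicHull-step (proj₁ c>0)
          (inj₁ ((β , extreme⇒circuit q∈K q-extreme q≉𝟎 , qβ≈-1) ,
            extreme⇒support q∈K q-extreme q≉𝟎))
          𝟎∈conicHull)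
    where
    ν∈N : tail p ∈ N β
    ν∈N = constraints⇒N p∈K
    -- The generators of the circuit graph have entry -1 at `β`, so `p` is divided by this number,
    -- which is positive by `balanced-zero`.
    c : ℝ
    c = - p (suc β)
    c>0 : 0# < c
    c>0 = balanced-nonpos β (proj₁ ν∈N) (proj₂ ν∈N) , λ 0≈c →
      ν≉𝟎 (balanced-zero β (proj₁ ν∈N) (proj₂ ν∈N)
        (trans (solve 1 (λ x → x := :- :- x) refl _)
          (trans (-‿cong (sym 0≈c)) (solve 0 (:- con (+ 0) := con (+ 0)) refl))))
    q : ℝ^ (suc m)
    q = c ⁻¹ ⊙ p
    rescale : ∀ i → c * q i + 0# ≈ p i
    rescale i = begin
      c * (c ⁻¹ * p i) + 0#   ≈⟨ solve 3 (λ c h x →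
        c :* (h :* x) :+ con (+ 0) := (c :* h) :* x) refl c (c ⁻¹) (p i) ⟩
      c * c ⁻¹ * p i          ≈⟨ *-congʳ (*⁻¹-inverse c>0) ⟩
      1# * p i                ≈⟨ *-identityˡ _ ⟩
      p i                     ∎
    q∈K : q ∈ K
    q∈K = K-⊙ (proj₁ (⁻¹-pos c>0)) p∈K
    q-extreme : OnExtremeRay q
    q-extreme = OnExtremeRay-⊙ (⁻¹-pos c>0) p-extreme
    qβ≈-1 : q (suc β) ≈ - 1#
    qβ≈-1 = trans (solve 2 (λ h x → h :* x := :- (:- x :* h)) refl (c ⁻¹) (p (suc β)))
      (-‿cong (*⁻¹-inverse c>0))
    q≉𝟎 : ¬ (tail q ≋ 𝟎)
    q≉𝟎 q≋𝟎 = ν≉𝟎 λ α → trans (sym (rescale (suc α)))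
      (trans (+-congʳ (*-congˡ (q≋𝟎 α)))
        (solve 1 (λ c → c :* con (+ 0) :+ con (+ 0) := con (+ 0)) refl c))

  open Generation InCircuitGraph
    (λ e → conicHull-respects (e ∘ suc , e zero))
    conicHull-⊕ conicHull-⊙ extreme⇒inCircuitGraph
    public using () renaming (K⊆G to K⊆circuitGraph)

  -- Any upper bound `s` of the support function suffices, so exact values at the two summands need
  -- not be computed.
  slack⇒inCircuitGraph : ∀ {ν s} → ν ∈ N β → (∀ x → x ∈ X → 0# ≤ s + 𝒜[ ν ] ∙ x) →
                         (ν , s) ∈ circuitGraph
  slack⇒inCircuitGraph {ν} {s} ν∈N h = K⊆circuitGraph {s ∷ ν} (inCone ν∈N h)

-- Splitting a multiple of the circuit.

theorem6p2 : ExcludedMiddle (lsuc 0ℓ) →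
    (R : CompleteOrderedField) →
    let open ConvexGeometry R in
    (exp : ℝ → ℝ) → IsExponential exp →
    (n m : ℕ) → NonZero m →
    (X : Pred (ℝ^ n) 0ℓ) → IsConvex X → Satisfiable X →
    (𝒜 : Vector (ℝ^ n) m) → Injective _≡_ _≋_ 𝒜 →
    LinearlyIndependentOn X (λ α x → exp (𝒜 α ∙ x)) →
    let open SublinearCircuits X 𝒜 in
    (β : Fin m) (ν : ℝ^ m) → ν ∈ Λ β →
    (∃[ β′ ] β′ ∉ supp ν ×
    (∃[ ν′ ] ν′ ∈ N β′ × ν′ β′ ≈ - 1# × (ν′ ⁺) ⊆ supp ν ×
    (∃[ γ ] 0# ≤ γ × 𝒜[ ν′ ] ≋ γ ⊙ 𝒜[ ν ]))) →
    ¬ IsReduced ν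
theorem6p2 em R exp _ n m _ X _ X-nonempty 𝒜 _ _ β ν (ν-circuit , _)
  (β′ , β′∉supp , ν′ , ν′∈N , ν′β′≈-1 , ν′⁺⊆supp , γ , γ≥0 , 𝒜ν′≋γ𝒜ν)
  (_ , s , s-support , extremeRay) = β′∉supp λ νβ′≈0 → 0≉1 (begin
    0#                  ≈⟨ solve 1 (λ t → con (+ 0) := :- (t :* con (+ 0))) refl t ⟩
    - (t * 0#)          ≈⟨ -‿cong (*-congˡ νβ′≈0) ⟨
    - (t * ν β′)        ≈⟨ -‿cong (ν′≋tν β′) ⟨
    - ν′ β′             ≈⟨ -‿cong ν′β′≈-1 ⟩
    - - 1#              ≈⟨ solve 0 (:- :- con 1ℤ := con 1ℤ) refl ⟩
    1#                  ∎)
  where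
  open ConvexGeometry R hiding (zero)
  open SublinearCircuits X 𝒜
  open IntegerCoefficients R
  open LinearFunctionals R
  open OrderedFieldProperties R
  open import Relation.Binary.Reasoning.Setoid setoid

  em₀ : ExcludedMiddle 0ℓ
  em₀ {P} = map′ lower lift (em {Lift (lsuc 0ℓ) P})

  module Cone = CircuitCone em₀ R X X-nonempty 𝒜

  ν∈N : ν ∈ N β
  ν∈N = IsCircuit.member ν-circuit

  -- The ratio of `ν′ α` to `ν α` where `ν′ α` is positive, the support hypothesis making `ν α`
  -- nonzero; zero where `ν′ α` is not positive, and at `β`, where nothing is demanded.
  bound : ∀ α → ∃[ c ] 0# ≤ c × (¬ (α ≡ β) → 0# ≤ c * ν α - ν′ α)
  bound α with em₀ {α ≡ β} | em₀ {ν′ α ≤ 0#}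
  ... | yes α≡β | _ = 0# , ≤-refl , λ α≢β → contradiction α≡β α≢β
  ... | no _    | yes ν′α≤0 = 0# , ≤-refl , λ _ → nonneg-resp
    (solve 2 (λ x y → :- y := con (+ 0) :* x :- y) refl (ν α) (ν′ α)) (neg-nonneg ν′α≤0)
  ... | no α≢β  | no ν′α≰0 = ν′ α * ν α ⁻¹ ,
    *-nonneg (proj₁ (≰⇒> ν′α≰0)) (proj₁ (⁻¹-pos να>0)) ,
    λ _ → ≤-reflexive (begin
      0#                               ≈⟨ -‿inverseʳ (ν′ α) ⟨
      ν′ α - ν′ α                      ≈⟨ +-congʳ (*-identityʳ _) ⟨
      ν′ α * 1# - ν′ α                 ≈⟨ +-congʳ (*-congˡ (*⁻¹-inverse να>0)) ⟨
      ν′ α * (ν α * ν α ⁻¹) - ν′ α     ≈⟨ solve 3 (λ y x h →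
        y :* (x :* h) :- y := y :* h :* x :- y) refl (ν′ α) (ν α) (ν α ⁻¹) ⟩
      ν′ α * ν α ⁻¹ * ν α - ν′ α       ∎)
    where
    να>0 : 0# < ν α
    να>0 = proj₁ ν∈N α α≢β , ν′⁺⊆supp (≰⇒> ν′α≰0) ∘ sym

  c : ℝ^ m
  c α = proj₁ (bound α)
  c≥0 : ∀ α → 0# ≤ c α
  c≥0 α = proj₁ (proj₂ (bound α))
  -- The sum dominates every `c α`, in place of a maximum. Adding `γ` makes the slack of the
  -- remainder `sum c` times that of `ν`, a nonnegative multiple.
  C : ℝ
  C = γ + sum c

  ν-slack : ∀ x → x ∈ X → 0# ≤ s + 𝒜[ ν ] ∙ x
  ν-slack = Cone.supportBound⇒slack β (proj₁ s-support)

  𝒜ν′∙≈ : ∀ x → 𝒜[ ν′ ] ∙ x ≈ γ * (𝒜[ ν ] ∙ x)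
  𝒜ν′∙≈ x = trans (IsLinear.cong (∙-isLinearˡ x) 𝒜ν′≋γ𝒜ν)
    (IsLinear.homogeneous (∙-isLinearˡ x) γ 𝒜[ ν ])

  ν′∈graph : (ν′ , γ * s) ∈ circuitGraph
  ν′∈graph = Cone.slack⇒inCircuitGraph β′ ν′∈N λ x x∈X →
    nonneg-resp (trans (distribˡ γ s _) (+-congˡ (sym (𝒜ν′∙≈ x))))
      (*-nonneg γ≥0 (ν-slack x x∈X))

  rest∈N : C ⊙ ν ⊖ ν′ ∈ N β
  rest∈N =
    (λ α α≢β → nonneg-resp
      (solve 4 (λ C c x y → (C :- c) :* x :+ (c :* x :- y) := C :* x :- y) refl
        C (c α) (ν α) (ν′ α))
      (+-nonneg
        (*-nonneg
          (nonneg-resp (solve 3 (λ γ S c → γ :+ (S :- c) := (γ :+ S) :- c) refl γ (sum c) (c α))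
            (+-nonneg γ≥0 (≤⇒0≤- (coordinate≤sum c c≥0 α))))
          (proj₁ ν∈N α α≢β))
        (proj₂ (proj₂ (bound α)) α≢β))) ,
    (begin
      sum (C ⊙ ν ⊖ ν′)      ≈⟨ IsLinearProperties.affine⁻ sum-isLinear C ν ν′ ⟩
      C * sum ν - sum ν′    ≈⟨ +-cong (*-congˡ (proj₂ ν∈N)) (-‿cong (proj₂ ν′∈N)) ⟩
      C * 0# - 0#           ≈⟨ solve 1 (λ C → C :* con (+ 0) :- con (+ 0) := con (+ 0)) refl C ⟩
      0#                    ∎)

  rest∈graph : (C ⊙ ν ⊖ ν′ , sum c * s) ∈ circuitGraph
  rest∈graph = Cone.slack⇒inCircuitGraph β rest∈N λ x x∈X → nonneg-resp
    (begin
      sum c * (s + 𝒜[ ν ] ∙ x)                               ≈⟨ solve 4 (λ γ S s a →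
        S :* (s :+ a) := S :* s :+ ((γ :+ S) :* a :- γ :* a)) refl γ (sum c) s (𝒜[ ν ] ∙ x) ⟩
      sum c * s + (C * (𝒜[ ν ] ∙ x) - γ * (𝒜[ ν ] ∙ x))      ≈⟨ +-congˡ (+-congˡ (-‿cong (𝒜ν′∙≈ x))) ⟨
      sum c * s + (C * (𝒜[ ν ] ∙ x) - 𝒜[ ν′ ] ∙ x)           ≈⟨ +-congˡ
        (IsLinearProperties.affine⁻ (Cone.𝒜∙-isLinear β x) C ν ν′) ⟨
      sum c * s + 𝒜[ C ⊙ ν ⊖ ν′ ] ∙ x                        ∎)
    (*-nonneg (sum-nonneg c c≥0) (ν-slack x x∈X))

  ν′∈ray : (ν′ , γ * s) ∈ ray (ν , s)
  ν′∈ray = proj₂ (GeneratesExtremeRay.extreme extremeRay _ _ rest∈graph ν′∈graph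
    (C , +-nonneg γ≥0 (sum-nonneg c c≥0) ,
      (λ α → solve 3 (λ C x y → (C :* x :- y) :+ y := C :* x) refl C (ν α) (ν′ α)) ,
      solve 3 (λ γ S s → S :* s :+ γ :* s := (γ :+ S) :* s) refl γ (sum c) s))

  t : ℝ
  t = proj₁ ν′∈ray
  ν′≋tν : ν′ ≋ t ⊙ ν
  ν′≋tν = proj₁ (proj₂ (proj₂ ν′∈ray))
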